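{- For every integer $k\ge1$, $$E^{k(k-1)\cdots1}_{3\text{ - }21}(x)=\begin{cases}0,&\text{if }k\ge3,\\[1mm] e^{e^x}\displaystyle\int_0^x e^{ -e^t}(e^t-1)\,dt,&\text{if }k=2,\\[2mm] e^{e^x-1},&\text{if }k=1.\end{cases}$$
   Context: A permutation $\pi=\pi_1\cdots\pi_n$ of $\{1,\dots,n\}$ contains the generalized pattern $3\text{ - }21$ if there are indices $i<j<n$ such that $\pi_i\pi_j\pi_{j+1}$ is order-isomorphic to $321$; otherwise it avoids it. A permutation $\pi$ begins with a pattern $p=p_1\cdots p_k$ if $n\ge k$ and $\pi_1\cdots\pi_k$ is order-isomorphic to $p$; by convention, the empty permutation is also regarded as beginning with the pattern $1$ (the case $k=1$). $E^p_q(x)=\sum_{n\ge0}N^p_q(n)\frac{x^n}{n!}$, where $N^p_q(n)$ is the number of permutations of $\{1,\dots,n\}$ that avoid $q$ and begin with $p$. Identities are identities of power series in $x$. -}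

module Defs where

open import Data.Fin.Base as Fin using (Fin; toℕ)
import Data.Fin.Properties as Fin
open import Data.Integer.Base as ℤ using (+_)
import Data.Integer.Properties as ℤ
open import Data.List.Base using (List; []; _∷_; length; filter; cartesianProductWith; allFin)
open import Data.Nat.Base as ℕ using (ℕ; zero; suc; _!)
import Data.Nat.Properties as ℕ
open import Data.Nat.Properties using (_!≢0)
open import Data.Product.Base using (Σ; ∃; ∃-syntax; _×_; _,_; proj₁; proj₂)
open import Data.Rational.Base hiding (truncate)
open import Data.Rational.Properties
open import Algebra.Definitions.RawSemiring +-*-rawSemiring using (_^_)
open import Data.Rational.Solver using (module +-*-Solver)
import Data.Rational.Unnormalised.Base as ℚᵘ
import Data.Rational.Unnormalised.Properties as ℚᵘ
open import Data.Sum.Base using (_⊎_; inj₁; inj₂)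
open import Data.Vec.Base as Vec using (Vec; []; _∷_; lookup; truncate)
open import Data.Vec.Relation.Unary.AllPairs using (allPairs?)
open import Data.Vec.Relation.Unary.Unique.Propositional using (Unique)
open import Function.Base using (_∘_)
open import Function.Bundles using (_⇔_; mk⇔; Equivalence)
open import Relation.Binary.PropositionalEquality
open import Relation.Nullary.Decidable using (Dec; yes; no; ¬?; map′; _×-dec_; _⊎-dec_; _→-dec_)
open import Relation.Nullary.Negation using (¬_)
open import Relation.Unary using (Decidable)

-- Permutations in one-line notation: π₁ ⋯ πₙ is a vector over Fin n, which stands
-- for {1,…,n} with values shifted down by one; only their relative order matters.

IsPermutation : ∀ {n} → Vec (Fin n) n → Set
IsPermutation π = Unique π

OrderIsomorphic : ∀ {k} → Vec ℕ k → Vec ℕ k → Set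
OrderIsomorphic u v = ∀ i j → lookup u i ℕ.< lookup u j ⇔ lookup v i ℕ.< lookup v j

-- i, j and j⁺ are the positions i < j and j + 1.
Contains3-21 : ∀ {n} → Vec (Fin n) n → Set
Contains3-21 {n} π = ∃[ i ] ∃[ j ] ∃[ j⁺ ] i Fin.< j × toℕ j⁺ ≡ suc (toℕ j) ×
  OrderIsomorphic (Vec.map (toℕ ∘ lookup π) (i ∷ j ∷ j⁺ ∷ [])) (3 ∷ 2 ∷ 1 ∷ [])

Avoids3-21 : ∀ {n} → Vec (Fin n) n → Set
Avoids3-21 π = ¬ Contains3-21 π

-- The second summand is the convention for the empty permutation.
BeginsWith : ∀ {k n} → Vec ℕ k → Vec (Fin n) n → Set
BeginsWith {k} {n} p π =
  (Σ (k ℕ.≤ n) λ k≤n → OrderIsomorphic (Vec.map toℕ (truncate k≤n π)) p)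
  ⊎ (n ≡ 0 × k ≡ 1)

isPermutation? : ∀ {n} → Decidable (IsPermutation {n})
isPermutation? = allPairs? (λ x y → ¬? (x Fin.≟ y))

_⇔?_ : ∀ {A B : Set} → Dec A → Dec B → Dec (A ⇔ B)
a? ⇔? b? = map′ (λ (f , g) → mk⇔ f g) (λ e → Equivalence.to e , Equivalence.from e)
  ((a? →-dec b?) ×-dec (b? →-dec a?))

orderIsomorphic? : ∀ {k} (u v : Vec ℕ k) → Dec (OrderIsomorphic u v)
orderIsomorphic? u v = Fin.all? λ i → Fin.all? λ j →
  (lookup u i ℕ.<? lookup u j) ⇔? (lookup v i ℕ.<? lookup v j)

contains3-21? : ∀ {n} → Decidable (Contains3-21 {n})
contains3-21? π = Fin.any? λ i → Fin.any? λ j → Fin.any? λ j⁺ →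
  (i Fin.<? j) ×-dec ((toℕ j⁺ ℕ.≟ suc (toℕ j)) ×-dec
  orderIsomorphic? (Vec.map (toℕ ∘ lookup π) (i ∷ j ∷ j⁺ ∷ [])) (3 ∷ 2 ∷ 1 ∷ []))

avoids3-21? : ∀ {n} → Decidable (Avoids3-21 {n})
avoids3-21? π = ¬? (contains3-21? π)

beginsWith? : ∀ {k n} (p : Vec ℕ k) → Decidable (BeginsWith {k} {n} p)
beginsWith? {k} {n} p π = long? ⊎-dec ((n ℕ.≟ 0) ×-dec (k ℕ.≟ 1))
  where
  long? : Dec (Σ (k ℕ.≤ n) λ k≤n → OrderIsomorphic (Vec.map toℕ (truncate k≤n π)) p)
  long? with k ℕ.≤? n
  ... | no k≰n   = no (λ (k≤n , _) → k≰n k≤n)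
  ... | yes k≤n  = map′ (k≤n ,_)
    (λ (k≤n′ , iso) → subst (λ q → OrderIsomorphic (Vec.map toℕ (truncate q π)) p)
                        (ℕ.≤-irrelevant k≤n′ k≤n) iso)
    (orderIsomorphic? (Vec.map toℕ (truncate k≤n π)) p)

words : ∀ n k → List (Vec (Fin n) k)
words n zero    = [] ∷ []
words n (suc k) = cartesianProductWith _∷_ (allFin n) (words n k)

N3-21 : ∀ {k} → Vec ℕ k → ℕ → ℕ
N3-21 p n = length (filter
  (λ π → isPermutation? π ×-dec (avoids3-21? π ×-dec beginsWith? p π)) (words n n))

-- k (k-1) ⋯ 1
decreasing : ∀ k → Vec ℕ k
decreasing zero    = []
decreasing (suc k) = suc k ∷ decreasing k

∑≤ℚ : ℕ → (ℕ → ℚ) → ℚ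
∑≤ℚ zero    f = f 0
∑≤ℚ (suc n) f = ∑≤ℚ n f + f (suc n)

1/! : ℕ → ℚ
1/! n = _/_ (+ 1) (n !) {{ n !≢0 }}

expTerm : ℚ → ℕ → ℚ
expTerm q j = 1/! j * q ^ j

expSum : ℕ → ℚ → ℚ
expSum n q = ∑≤ℚ n (expTerm q)

Cauchy : (ℕ → ℚ) → Set
Cauchy s = ∀ ε → 0ℚ < ε → ∃ λ N → ∀ m n → N ℕ.≤ m → N ℕ.≤ n → ∣ s m - s n ∣ < ε

dist-swap : ∀ a b → ∣ a - b ∣ ≡ ∣ b - a ∣
dist-swap a b = trans (sym (∣-p∣≡∣p∣ (a - b))) (cong ∣_∣ (+-*-Solver.solve 2 (λ a b → :- (a :- b) := b :- a) refl a b))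
  where open +-*-Solver

dist-triangle : ∀ a b c → ∣ a - c ∣ ≤ ∣ a - b ∣ + ∣ b - c ∣
dist-triangle a b c = subst (_≤ ∣ a - b ∣ + ∣ b - c ∣)
  (cong ∣_∣ (+-*-Solver.solve 3 (λ a b c → (a :- b) :+ (b :- c) := a :- c) refl a b c))
  (∣p+q∣≤∣p∣+∣q∣ (a - b) (b - c))
  where open +-*-Solver

half-pos : ∀ {ε} → 0ℚ < ε → 0ℚ < ½ * ε
half-pos {ε} ε>0 = subst (_< ½ * ε) (*-zeroʳ ½) (*-monoʳ-<-pos ½ ε>0)

half+half : ∀ ε → ½ * ε + ½ * ε ≡ ε
half+half = +-*-Solver.solve 1 (λ e → con ½ :* e :+ con ½ :* e := e) refl
  where open +-*-Solver

cauchy-ordered : ∀ s →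
  (∀ ε → 0ℚ < ε → ∃ λ N → ∀ m n → N ℕ.≤ m → m ℕ.≤ n → ∣ s n - s m ∣ < ε) → Cauchy s
cauchy-ordered s c ε ε>0 with c ε ε>0
... | N , h = N , go
  where
  go : ∀ m n → N ℕ.≤ m → N ℕ.≤ n → ∣ s m - s n ∣ < ε
  go m n N≤m N≤n with ℕ.≤-total m n
  ... | inj₁ m≤n = subst (_< ε) (dist-swap (s n) (s m)) (h m n N≤m m≤n)
  ... | inj₂ n≤m = h n m N≤n n≤m

dist-shrink : ∀ {a b c ε} → ∣ a - b ∣ < ½ * ε → ∣ b - c ∣ < ½ * ε → ∣ a - c ∣ < ε
dist-shrink {a} {b} {c} {ε} p q = subst (∣ a - c ∣ <_) (half+half ε)
  (≤-<-trans (dist-triangle a b c) (+-mono-< p q))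

p≤p+q : ∀ p {q} → 0ℚ ≤ q → p ≤ p + q
p≤p+q p {q} q≥0 = subst (_≤ p + q) (+-identityʳ p) (+-monoʳ-≤ p q≥0)

q≤p+q : ∀ {p} q → 0ℚ ≤ p → q ≤ p + q
q≤p+q {p} q p≥0 = subst (_≤ p + q) (+-identityˡ q) (+-monoˡ-≤ q p≥0)

*-mono-nonneg : ∀ {a b c d} → 0ℚ ≤ a → 0ℚ ≤ d → a ≤ b → c ≤ d → a * c ≤ b * d
*-mono-nonneg {a} {b} {c} {d} a≥0 d≥0 a≤b c≤d =
  ≤-trans (*-monoˡ-≤-nonNeg a {{nonNegative a≥0}} c≤d)
          (*-monoʳ-≤-nonNeg d {{nonNegative d≥0}} a≤b)

*-nonneg : ∀ {a b} → 0ℚ ≤ a → 0ℚ ≤ b → 0ℚ ≤ a * b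
*-nonneg {a} {b} a≥0 b≥0 =
  subst (_≤ a * b) (*-zeroʳ a) (*-monoˡ-≤-nonNeg a {{nonNegative a≥0}} b≥0)

+-nonneg : ∀ {a b} → 0ℚ ≤ a → 0ℚ ≤ b → 0ℚ ≤ a + b
+-nonneg {a} {b} a≥0 b≥0 = ≤-trans a≥0 (p≤p+q a b≥0)

absSum : (ℕ → ℚ) → ℕ → ℚ
absSum s n = ∑≤ℚ n (λ i → ∣ s i ∣)

absSum≥0 : ∀ s n → 0ℚ ≤ absSum s n
absSum≥0 s zero    = 0≤∣p∣ (s 0)
absSum≥0 s (suc n) = +-nonneg (absSum≥0 s n) (0≤∣p∣ (s (suc n)))

abs≤absSum : ∀ s n i → i ℕ.≤ n → ∣ s i ∣ ≤ absSum s n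
abs≤absSum s zero    i i≤0 rewrite ℕ.n≤0⇒n≡0 i≤0 = ≤-refl
abs≤absSum s (suc n) i i≤1+n with ℕ.m≤n⇒m<n∨m≡n i≤1+n
... | inj₁ (ℕ.s≤s i≤n) = ≤-trans (abs≤absSum s n i i≤n) (p≤p+q _ (0≤∣p∣ (s (suc n))))
... | inj₂ refl        = q≤p+q _ (absSum≥0 s n)

0<1 : 0ℚ < 1ℚ
0<1 = positive⁻¹ 1ℚ

bounded : ∀ s → Cauchy s → ∃ λ B → 1ℚ ≤ B × (∀ n → ∣ s n ∣ ≤ B)
bounded s c with c 1ℚ 0<1
... | N , h = absSum s N + 1ℚ , q≤p+q 1ℚ (absSum≥0 s N) , bound
  where
  bound : ∀ n → ∣ s n ∣ ≤ absSum s N + 1ℚ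
  bound n with ℕ.≤-total n N
  ... | inj₁ n≤N = ≤-trans (abs≤absSum s N n n≤N) (p≤p+q _ (<⇒≤ 0<1))
  ... | inj₂ N≤n = begin
    ∣ s n ∣                   ≡⟨ cong ∣_∣ (+-*-Solver.solve 2 (λ a b → a := b :+ (a :- b)) refl (s n) (s N)) ⟩
    ∣ s N + (s n - s N) ∣     ≤⟨ ∣p+q∣≤∣p∣+∣q∣ (s N) (s n - s N) ⟩
    ∣ s N ∣ + ∣ s n - s N ∣   ≤⟨ +-mono-≤ (abs≤absSum s N N ℕ.≤-refl) (<⇒≤ (h n N N≤n ℕ.≤-refl)) ⟩
    absSum s N + 1ℚ           ∎
    where open ≤-Reasoning
          open +-*-Solver

-- a distance below δ, scaled by C, is below ε
scale : ∀ C ε → 1ℚ ≤ C → 0ℚ < ε → ∃ λ δ → 0ℚ < δ × (∀ {d} → d < δ → d * C < ε)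
scale C ε 1≤C ε>0 = ε * 1/ C , δ>0 , below
  where
  instance
    C-pos : Positive C
    C-pos = positive (<-≤-trans 0<1 1≤C)
    C-nz : NonZero C
    C-nz = pos⇒nonZero C
    invC-pos : Positive (1/ C)
    invC-pos = 1/pos⇒pos C
  δ>0 : 0ℚ < ε * 1/ C
  δ>0 = subst (_< ε * 1/ C) (*-zeroˡ (1/ C)) (*-monoˡ-<-pos (1/ C) ε>0)
  below : ∀ {d} → d < ε * 1/ C → d * C < ε
  below {d} d<δ = subst (d * C <_)
    (trans (*-assoc ε (1/ C) C) (trans (cong (ε *_) (*-inverseˡ C)) (*-identityʳ ε)))
    (*-monoˡ-<-pos C d<δ)

cauchy-+ : ∀ s t → Cauchy s → Cauchy t → Cauchy (λ n → s n + t n)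
cauchy-+ s t cs ct ε ε>0 with cs (½ * ε) (half-pos ε>0) | ct (½ * ε) (half-pos ε>0)
... | M , hs | N , ht = M ℕ.⊔ N , λ m n p q →
  subst (_ <_) (half+half ε) (≤-<-trans
    (subst (_≤ ∣ s m - s n ∣ + ∣ t m - t n ∣) (cong ∣_∣ (eq (s m) (s n) (t m) (t n)))
      (∣p+q∣≤∣p∣+∣q∣ (s m - s n) (t m - t n)))
    (+-mono-< (hs m n (ℕ.m⊔n≤o⇒m≤o M N p) (ℕ.m⊔n≤o⇒m≤o M N q))
              (ht m n (ℕ.m⊔n≤o⇒n≤o M N p) (ℕ.m⊔n≤o⇒n≤o M N q))))
  where
  eq : ∀ a b c d → (a - b) + (c - d) ≡ (a + c) - (b + d)
  eq = +-*-Solver.solve 4 (λ a b c d → (a :- b) :+ (c :- d) := (a :+ c) :- (b :+ d)) refl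
    where open +-*-Solver

cauchy-neg : ∀ s → Cauchy s → Cauchy (λ n → - s n)
cauchy-neg s cs ε ε>0 with cs ε ε>0
... | N , h = N , λ m n p q → subst (_< ε) (eq (s n) (s m)) (h n m q p)
  where
  eq : ∀ a b → ∣ a - b ∣ ≡ ∣ - b - - a ∣
  eq a b = cong ∣_∣ (+-*-Solver.solve 2 (λ a b → a :- b := :- b :- :- a) refl a b)
    where open +-*-Solver

cauchy-* : ∀ s t → Cauchy s → Cauchy t → Cauchy (λ n → s n * t n)
cauchy-* s t cs ct ε ε>0 with bounded s cs | bounded t ct
... | B , 1≤B , sB | C , 1≤C , tC
  with scale C (½ * ε) 1≤C (half-pos ε>0) | scale B (½ * ε) 1≤B (half-pos ε>0)
... | δ , δ>0 , hδ | η , η>0 , hη with cs δ δ>0 | ct η η>0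
... | M , hs | N , ht = M ℕ.⊔ N , λ m n p q → begin-strict
  ∣ s m * t m - s n * t n ∣
    ≡⟨ cong ∣_∣ (eq (s m) (s n) (t m) (t n)) ⟩
  ∣ (s m - s n) * t m + (t m - t n) * s n ∣
    ≤⟨ ∣p+q∣≤∣p∣+∣q∣ ((s m - s n) * t m) ((t m - t n) * s n) ⟩
  ∣ (s m - s n) * t m ∣ + ∣ (t m - t n) * s n ∣
    ≡⟨ cong₂ _+_ (∣p*q∣≡∣p∣*∣q∣ (s m - s n) (t m)) (∣p*q∣≡∣p∣*∣q∣ (t m - t n) (s n)) ⟩
  ∣ s m - s n ∣ * ∣ t m ∣ + ∣ t m - t n ∣ * ∣ s n ∣
    ≤⟨ +-mono-≤ (mul≤ (s m - s n) (tC m)) (mul≤ (t m - t n) (sB n)) ⟩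
  ∣ s m - s n ∣ * C + ∣ t m - t n ∣ * B
    <⟨ +-mono-< (hδ (hs m n (ℕ.m⊔n≤o⇒m≤o M N p) (ℕ.m⊔n≤o⇒m≤o M N q)))
                (hη (ht m n (ℕ.m⊔n≤o⇒n≤o M N p) (ℕ.m⊔n≤o⇒n≤o M N q))) ⟩
  ½ * ε + ½ * ε
    ≡⟨ half+half ε ⟩
  ε ∎
  where
  open ≤-Reasoning
  mul≤ : ∀ a {b c} → b ≤ c → ∣ a ∣ * b ≤ ∣ a ∣ * c
  mul≤ a = *-monoˡ-≤-nonNeg ∣ a ∣ {{∣-∣-nonNeg a}}
  eq : ∀ a b c d → a * c - b * d ≡ (a - b) * c + (c - d) * b
  eq = +-*-Solver.solve 4 (λ a b c d → a :* c :- b :* d := (a :- b) :* c :+ (c :- d) :* b) refl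
    where open +-*-Solver

fromℕ : ℕ → ℚ
fromℕ n = + n / 1

toℚᵘ-fromℕ : ∀ n → toℚᵘ (fromℕ n) ℚᵘ.≃ ℚᵘ.mkℚᵘ (+ n) 0
toℚᵘ-fromℕ n = toℚᵘ-fromℚᵘ (ℚᵘ.mkℚᵘ (+ n) 0)

fromℕ-mono : ∀ {m n} → m ℕ.≤ n → fromℕ m ≤ fromℕ n
fromℕ-mono {m} {n} m≤n = toℚᵘ-cancel-≤
  (ℚᵘ.≤-respˡ-≃ (ℚᵘ.≃-sym (toℚᵘ-fromℕ m)) (ℚᵘ.≤-respʳ-≃ (ℚᵘ.≃-sym (toℚᵘ-fromℕ n))
    (ℚᵘ.*≤* (ℤ.*-monoʳ-≤-nonNeg (+ 1) (ℤ.+≤+ m≤n)))))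

fromℕ≥0 : ∀ n → 0ℚ ≤ fromℕ n
fromℕ≥0 n = fromℕ-mono (ℕ.z≤n {n})

fromℕ-< : ∀ n → fromℕ n < fromℕ (suc n)
fromℕ-< n = toℚᵘ-cancel-<
  (ℚᵘ.<-respˡ-≃ (ℚᵘ.≃-sym (toℚᵘ-fromℕ n)) (ℚᵘ.<-respʳ-≃ (ℚᵘ.≃-sym (toℚᵘ-fromℕ (suc n)))
    (ℚᵘ.*<* (ℤ.*-monoʳ-<-pos (+ 1) (ℤ.+<+ (ℕ.n<1+n n))))))

archimedean : ∀ q → ∃ λ n → q ≤ fromℕ n
archimedean q@(mkℚ (+ n) d-1 _) = n , toℚᵘ-cancel-≤ (ℚᵘ.≤-respʳ-≃ (ℚᵘ.≃-sym (toℚᵘ-fromℕ n))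
  (ℚᵘ.*≤* (ℤ.*-monoˡ-≤-nonNeg (+ n) (ℤ.+≤+ (ℕ.s≤s (ℕ.z≤n {d-1}))))))
archimedean q@(mkℚ ℤ.-[1+ n ] d-1 _) = 0 , <⇒≤ (negative⁻¹ q)

1/!-suc : ∀ n → 1/! (suc n) * fromℕ (suc n) ≡ 1/! n
1/!-suc n = go n (n !) {{n !≢0}} {{suc n !≢0}}
  where
  go : ∀ n d .{{_ : ℕ.NonZero d}} .{{_ : ℕ.NonZero (suc n ℕ.* d)}} →
       (+ 1 / (suc n ℕ.* d)) * fromℕ (suc n) ≡ + 1 / d
  go n (suc d) = toℚᵘ-injective (begin
    toℚᵘ ((+ 1 / (suc n ℕ.* suc d)) * fromℕ (suc n))
      ≈⟨ toℚᵘ-homo-* (+ 1 / (suc n ℕ.* suc d)) (fromℕ (suc n)) ⟩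
    toℚᵘ (+ 1 / (suc n ℕ.* suc d)) ℚᵘ.* toℚᵘ (fromℕ (suc n))
      ≈⟨ ℚᵘ.*-cong (toℚᵘ-fromℚᵘ (ℚᵘ.mkℚᵘ (+ 1) (d ℕ.+ n ℕ.* suc d))) (toℚᵘ-fromℕ (suc n)) ⟩
    ℚᵘ.mkℚᵘ (+ 1) (d ℕ.+ n ℕ.* suc d) ℚᵘ.* ℚᵘ.mkℚᵘ (+ suc n) 0
      ≈⟨ ℚᵘ.*≡* (cong +_ (eq n d)) ⟩
    ℚᵘ.mkℚᵘ (+ 1) d
      ≈⟨ ℚᵘ.≃-sym (toℚᵘ-fromℚᵘ (ℚᵘ.mkℚᵘ (+ 1) d)) ⟩
    toℚᵘ (+ 1 / suc d) ∎)
    where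
    open ℚᵘ.≃-Reasoning
    eq : ∀ n d → (1 ℕ.* suc n) ℕ.* suc d ≡ 1 ℕ.* ((suc n ℕ.* suc d) ℕ.* 1)
    eq n d = trans (cong (ℕ._* suc d) (ℕ.*-identityˡ (suc n)))
      (sym (trans (ℕ.*-identityˡ _) (ℕ.*-identityʳ (suc n ℕ.* suc d))))

expTerm-suc : ∀ q j → expTerm q (suc j) * fromℕ (suc j) ≡ expTerm q j * q
expTerm-suc q j = begin
  1/! (suc j) * (q * q ^ j) * fromℕ (suc j)  ≡⟨ eq (1/! (suc j)) q (q ^ j) (fromℕ (suc j)) ⟩
  1/! (suc j) * fromℕ (suc j) * q ^ j * q    ≡⟨ cong (λ r → r * q ^ j * q) (1/!-suc j) ⟩
  1/! j * q ^ j * q                          ∎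
  where
  open ≡-Reasoning
  eq : ∀ a b c d → a * (b * c) * d ≡ a * d * c * b
  eq = +-*-Solver.solve 4 (λ a b c d → a :* (b :* c) :* d := a :* d :* c :* b) refl
    where open +-*-Solver

1/!≥0 : ∀ n → 0ℚ ≤ 1/! n
1/!≥0 n = nonNegative⁻¹ (1/! n) {{normalize-nonNeg 1 (n !) {{n !≢0}}}}

^-nonneg : ∀ {q} n → 0ℚ ≤ q → 0ℚ ≤ q ^ n
^-nonneg zero    q≥0 = <⇒≤ 0<1
^-nonneg (suc n) q≥0 = *-nonneg q≥0 (^-nonneg n q≥0)

expTerm≥0 : ∀ {q} j → 0ℚ ≤ q → 0ℚ ≤ expTerm q j
expTerm≥0 j q≥0 = *-nonneg (1/!≥0 j) (^-nonneg j q≥0)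

^-abs : ∀ {q B} n → ∣ q ∣ ≤ B → ∣ q ^ n ∣ ≤ B ^ n
^-abs zero    _     = ≤-refl
^-abs {q} {B} (suc n) ∣q∣≤B = subst (_≤ B * B ^ n) (sym (∣p*q∣≡∣p∣*∣q∣ q (q ^ n)))
  (*-mono-nonneg (0≤∣p∣ q) (^-nonneg n (≤-trans (0≤∣p∣ q) ∣q∣≤B)) ∣q∣≤B (^-abs n ∣q∣≤B))

∣1/!*∣ : ∀ n q → ∣ 1/! n * q ∣ ≡ 1/! n * ∣ q ∣
∣1/!*∣ n q = trans (∣p*q∣≡∣p∣*∣q∣ (1/! n) q) (cong (_* ∣ q ∣) (0≤p⇒∣p∣≡p (1/!≥0 n)))

1/!*-mono : ∀ n {a b} → a ≤ b → 1/! n * a ≤ 1/! n * b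
1/!*-mono n = *-monoˡ-≤-nonNeg (1/! n) {{nonNegative (1/!≥0 n)}}

expTerm-abs : ∀ {q B} j → ∣ q ∣ ≤ B → ∣ expTerm q j ∣ ≤ expTerm B j
expTerm-abs {q} {B} j h =
  subst (_≤ expTerm B j) (sym (∣1/!*∣ j (q ^ j))) (1/!*-mono j (^-abs j h))

expSum-mono : ∀ {B m n} → 0ℚ ≤ B → m ℕ.≤ n → expSum m B ≤ expSum n B
expSum-mono {B} {m} {zero}  B≥0 m≤n rewrite ℕ.n≤0⇒n≡0 m≤n = ≤-refl
expSum-mono {B} {m} {suc n} B≥0 m≤n with ℕ.m≤n⇒m<n∨m≡n m≤n
... | inj₁ (ℕ.s≤s m≤n') = ≤-trans (expSum-mono B≥0 m≤n') (p≤p+q _ (expTerm≥0 (suc n) B≥0))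
... | inj₂ refl = ≤-refl

expSum≥0 : ∀ {B} n → 0ℚ ≤ B → 0ℚ ≤ expSum n B
expSum≥0 zero    B≥0 = expTerm≥0 0 B≥0
expSum≥0 (suc n) B≥0 = +-nonneg (expSum≥0 n B≥0) (expTerm≥0 (suc n) B≥0)

expSum-tail : ∀ {q B m n} → ∣ q ∣ ≤ B → m ℕ.≤ n → ∣ expSum n q - expSum m q ∣ ≤ expSum n B - expSum m B
expSum-tail {q} {B} {m} {n} h m≤n with ℕ.m≤n⇒m<n∨m≡n m≤n
expSum-tail {q} {B} {m} {n} h m≤n | inj₂ refl
  rewrite +-inverseʳ (expSum n q) | +-inverseʳ (expSum n B) = ≤-refl
expSum-tail {q} {B} {m} {suc n} h m≤n | inj₁ (ℕ.s≤s m≤n') = begin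
  ∣ (expSum n q + expTerm q (suc n)) - expSum m q ∣  ≡⟨ cong ∣_∣ (eq (expSum n q) (expTerm q (suc n)) (expSum m q)) ⟩
  ∣ (expSum n q - expSum m q) + expTerm q (suc n) ∣  ≤⟨ ∣p+q∣≤∣p∣+∣q∣ (expSum n q - expSum m q) (expTerm q (suc n)) ⟩
  ∣ expSum n q - expSum m q ∣ + ∣ expTerm q (suc n) ∣ ≤⟨ +-mono-≤ (expSum-tail h m≤n') (expTerm-abs (suc n) h) ⟩
  (expSum n B - expSum m B) + expTerm B (suc n)      ≡⟨ eq (expSum n B) (expTerm B (suc n)) (expSum m B) ⟨
  (expSum n B + expTerm B (suc n)) - expSum m B      ∎
  where
  open ≤-Reasoning
  eq : ∀ a b c → (a + b) - c ≡ (a - c) + b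
  eq = +-*-Solver.solve 3 (λ a b c → (a :+ b) :- c := (a :- c) :+ b) refl
    where open +-*-Solver

-- Once D + D ≤ n, the terms at least halve, so expSum n D + expTerm D n decreases.
expSum-tail≤term : ∀ {D K m n} → 0ℚ ≤ D → D + D ≤ fromℕ K → K ℕ.≤ m → m ℕ.≤ n →
                   expSum n D + expTerm D n ≤ expSum m D + expTerm D m
expSum-tail≤term {D} {K} {m} {n} D≥0 2D≤K K≤m m≤n with ℕ.m≤n⇒m<n∨m≡n m≤n
expSum-tail≤term {D} {K} {m} {n} D≥0 2D≤K K≤m m≤n | inj₂ refl = ≤-refl
expSum-tail≤term {D} {K} {m} {suc n} D≥0 2D≤K K≤m m≤n | inj₁ (ℕ.s≤s m≤n') =
  ≤-trans step (expSum-tail≤term D≥0 2D≤K K≤m m≤n')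
  where
  t t⁺ N : ℚ
  t  = expTerm D n
  t⁺ = expTerm D (suc n)
  N  = fromℕ (suc n)
  N-pos : 0ℚ < N
  N-pos = <-≤-trans 0<1 (fromℕ-mono (ℕ.s≤s (ℕ.z≤n {n})))
  double : t⁺ + t⁺ ≤ t
  double = *-cancelʳ-≤-pos N {{positive N-pos}} (begin
    (t⁺ + t⁺) * N       ≡⟨ *-distribʳ-+ N t⁺ t⁺ ⟩
    t⁺ * N + t⁺ * N     ≡⟨ cong₂ _+_ (expTerm-suc D n) (expTerm-suc D n) ⟩
    t * D + t * D       ≡⟨ *-distribˡ-+ t D D ⟨
    t * (D + D)         ≤⟨ *-monoˡ-≤-nonNeg t {{nonNegative (expTerm≥0 n D≥0)}}
                             (≤-trans 2D≤K (fromℕ-mono (ℕ.≤-trans K≤m m≤n))) ⟩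
    t * N               ∎)
    where open ≤-Reasoning
  step : expSum n D + t⁺ + t⁺ ≤ expSum n D + t
  step = subst (_≤ expSum n D + t) (sym (+-assoc (expSum n D) t⁺ t⁺)) (+-monoʳ-≤ (expSum n D) double)

expTerm-antitone : ∀ {D K n} → 0ℚ ≤ D → D + D ≤ fromℕ K → K ℕ.≤ n → expTerm D n ≤ expSum K D + expTerm D K
expTerm-antitone {D} {K} {n} D≥0 2D≤K K≤n =
  ≤-trans (q≤p+q (expTerm D n) (expSum≥0 n D≥0)) (expSum-tail≤term D≥0 2D≤K ℕ.≤-refl K≤n)

-- expTerm D (1 + n) · (1 + n) = expTerm D n · D stays bounded, hence expTerm D n → 0.
expTerm→0 : ∀ {D K} → 0ℚ ≤ D → D + D ≤ fromℕ K → ∀ ε → 0ℚ < ε →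
            ∃ λ N → ∀ n → N ℕ.≤ n → expTerm D n < ε
expTerm→0 {D} {K} D≥0 2D≤K ε ε>0 = suc (K ℕ.⊔ N) , small
  where
  instance
    ε-pos : Positive ε
    ε-pos = positive ε>0
    ε-nz : NonZero ε
    ε-nz = pos⇒nonZero ε
  C : ℚ
  C = (expSum K D + expTerm D K) * D
  N : ℕ
  N = proj₁ (archimedean (C * 1/ ε))
  C≤Nε : C ≤ fromℕ N * ε
  C≤Nε = subst (_≤ fromℕ N * ε)
    (trans (*-assoc C (1/ ε) ε) (trans (cong (C *_) (*-inverseˡ ε)) (*-identityʳ C)))
    (*-monoʳ-≤-nonNeg ε {{nonNegative (<⇒≤ ε>0)}} (proj₂ (archimedean (C * 1/ ε))))
  small : ∀ n → suc (K ℕ.⊔ N) ℕ.≤ n → expTerm D n < ε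
  small (suc n) (ℕ.s≤s K⊔N≤n) =
    *-cancelʳ-<-nonNeg (fromℕ (suc n)) {{nonNegative (fromℕ≥0 (suc n))}} (begin-strict
      expTerm D (suc n) * fromℕ (suc n)  ≡⟨ expTerm-suc D n ⟩
      expTerm D n * D                    ≤⟨ *-monoʳ-≤-nonNeg D {{nonNegative D≥0}}
                                              (expTerm-antitone D≥0 2D≤K (ℕ.m⊔n≤o⇒m≤o K N K⊔N≤n)) ⟩
      C                                  ≤⟨ C≤Nε ⟩
      fromℕ N * ε                        <⟨ *-monoˡ-<-pos ε (≤-<-trans (fromℕ-mono (ℕ.m⊔n≤o⇒n≤o K N K⊔N≤n)) (fromℕ-< n)) ⟩
      fromℕ (suc n) * ε                  ≡⟨ *-comm (fromℕ (suc n)) ε ⟩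
      ε * fromℕ (suc n)                  ∎)
    where open ≤-Reasoning

expSum-tail→0 : ∀ {D} → 0ℚ ≤ D → ∀ ε → 0ℚ < ε →
                ∃ λ N → ∀ m n → N ℕ.≤ m → m ℕ.≤ n → expSum n D - expSum m D < ε
expSum-tail→0 {D} D≥0 ε ε>0 with archimedean (D + D)
... | K , 2D≤K with expTerm→0 {D} {K} D≥0 2D≤K ε ε>0
... | N , h = K ℕ.⊔ N , λ m n p m≤n → begin-strict
  expSum n D - expSum m D
    ≤⟨ +-monoˡ-≤ (- expSum m D) (p≤p+q (expSum n D) (expTerm≥0 n D≥0)) ⟩
  (expSum n D + expTerm D n) - expSum m D
    ≤⟨ +-monoˡ-≤ (- expSum m D) (expSum-tail≤term {D} {K} D≥0 2D≤K (ℕ.m⊔n≤o⇒m≤o K N p) m≤n) ⟩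
  (expSum m D + expTerm D m) - expSum m D
    ≡⟨ eq (expSum m D) (expTerm D m) ⟩
  expTerm D m
    <⟨ h m (ℕ.m⊔n≤o⇒n≤o K N p) ⟩
  ε ∎
  where
  open ≤-Reasoning
  eq : ∀ a b → (a + b) - a ≡ b
  eq = +-*-Solver.solve 2 (λ a b → (a :+ b) :- a := b) refl
    where open +-*-Solver

-- crude Lipschitz estimates, with 2B in place of B to avoid the factor n
^-lipschitz : ∀ {B q r} n → 1ℚ ≤ B → ∣ q ∣ ≤ B → ∣ r ∣ ≤ B →
              ∣ q ^ n - r ^ n ∣ ≤ ∣ q - r ∣ * (B + B) ^ n
^-lipschitz {B} {q} {r} zero 1≤B _ _ = subst (0ℚ ≤_) (sym (*-identityʳ ∣ q - r ∣)) (0≤∣p∣ (q - r))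
^-lipschitz {B} {q} {r} (suc n) 1≤B hq hr = begin
  ∣ q * q ^ n - r * r ^ n ∣
    ≡⟨ cong ∣_∣ (eq q (q ^ n) r (r ^ n)) ⟩
  ∣ q * (q ^ n - r ^ n) + (q - r) * r ^ n ∣
    ≤⟨ ∣p+q∣≤∣p∣+∣q∣ (q * (q ^ n - r ^ n)) ((q - r) * r ^ n) ⟩
  ∣ q * (q ^ n - r ^ n) ∣ + ∣ (q - r) * r ^ n ∣
    ≡⟨ cong₂ _+_ (∣p*q∣≡∣p∣*∣q∣ q (q ^ n - r ^ n)) (∣p*q∣≡∣p∣*∣q∣ (q - r) (r ^ n)) ⟩
  ∣ q ∣ * ∣ q ^ n - r ^ n ∣ + ∣ q - r ∣ * ∣ r ^ n ∣
    ≤⟨ +-mono-≤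
         (*-mono-nonneg (0≤∣p∣ q) (*-nonneg δ≥0 P≥0) hq (^-lipschitz n 1≤B hq hr))
         (*-mono-nonneg δ≥0 (*-nonneg B≥0 P≥0) ≤-refl r^n≤) ⟩
  B * (∣ q - r ∣ * P) + ∣ q - r ∣ * (B * P)
    ≡⟨ eq′ B ∣ q - r ∣ P ⟩
  ∣ q - r ∣ * ((B + B) * P) ∎
  where
  open ≤-Reasoning
  P : ℚ
  P = (B + B) ^ n
  B≥0 : 0ℚ ≤ B
  B≥0 = ≤-trans (<⇒≤ 0<1) 1≤B
  P≥0 : 0ℚ ≤ P
  P≥0 = ^-nonneg n (+-nonneg B≥0 B≥0)
  δ≥0 : 0ℚ ≤ ∣ q - r ∣
  δ≥0 = 0≤∣p∣ (q - r)
  r^n≤ : ∣ r ^ n ∣ ≤ B * P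
  r^n≤ = ≤-trans (^-abs n (≤-trans hr (p≤p+q B B≥0)))
    (subst (_≤ B * P) (*-identityˡ P) (*-monoʳ-≤-nonNeg P {{nonNegative P≥0}} 1≤B))
  eq : ∀ a b c d → a * b - c * d ≡ a * (b - d) + (a - c) * d
  eq = +-*-Solver.solve 4 (λ a b c d → a :* b :- c :* d := a :* (b :- d) :+ (a :- c) :* d) refl
    where open +-*-Solver
  eq′ : ∀ a b c → a * (b * c) + b * (a * c) ≡ b * ((a + a) * c)
  eq′ = +-*-Solver.solve 3 (λ a b c → a :* (b :* c) :+ b :* (a :* c) := b :* ((a :+ a) :* c)) refl
    where open +-*-Solver

expTerm-lipschitz : ∀ {B q r} n → 1ℚ ≤ B → ∣ q ∣ ≤ B → ∣ r ∣ ≤ B →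
                    ∣ expTerm q n - expTerm r n ∣ ≤ ∣ q - r ∣ * expTerm (B + B) n
expTerm-lipschitz {B} {q} {r} n 1≤B hq hr = begin
  ∣ 1/! n * q ^ n - 1/! n * r ^ n ∣   ≡⟨ cong ∣_∣ (eq (1/! n) (q ^ n) (r ^ n)) ⟩
  ∣ 1/! n * (q ^ n - r ^ n) ∣         ≡⟨ ∣1/!*∣ n (q ^ n - r ^ n) ⟩
  1/! n * ∣ q ^ n - r ^ n ∣           ≤⟨ 1/!*-mono n (^-lipschitz n 1≤B hq hr) ⟩
  1/! n * (∣ q - r ∣ * (B + B) ^ n)   ≡⟨ eq′ (1/! n) ∣ q - r ∣ ((B + B) ^ n) ⟩
  ∣ q - r ∣ * (1/! n * (B + B) ^ n)   ∎
  where
  open ≤-Reasoning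
  eq : ∀ a b c → a * b - a * c ≡ a * (b - c)
  eq = +-*-Solver.solve 3 (λ a b c → a :* b :- a :* c := a :* (b :- c)) refl
    where open +-*-Solver
  eq′ : ∀ a b c → a * (b * c) ≡ b * (a * c)
  eq′ = +-*-Solver.solve 3 (λ a b c → a :* (b :* c) := b :* (a :* c)) refl
    where open +-*-Solver

expSum-lipschitz : ∀ {B q r} n → 1ℚ ≤ B → ∣ q ∣ ≤ B → ∣ r ∣ ≤ B →
                   ∣ expSum n q - expSum n r ∣ ≤ ∣ q - r ∣ * expSum n (B + B)
expSum-lipschitz zero 1≤B hq hr = expTerm-lipschitz 0 1≤B hq hr
expSum-lipschitz {B} {q} {r} (suc n) 1≤B hq hr = begin
  ∣ (expSum n q + expTerm q (suc n)) - (expSum n r + expTerm r (suc n)) ∣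
    ≡⟨ cong ∣_∣ (eq (expSum n q) (expTerm q (suc n)) (expSum n r) (expTerm r (suc n))) ⟩
  ∣ (expSum n q - expSum n r) + (expTerm q (suc n) - expTerm r (suc n)) ∣
    ≤⟨ ∣p+q∣≤∣p∣+∣q∣ (expSum n q - expSum n r) (expTerm q (suc n) - expTerm r (suc n)) ⟩
  ∣ expSum n q - expSum n r ∣ + ∣ expTerm q (suc n) - expTerm r (suc n) ∣
    ≤⟨ +-mono-≤ (expSum-lipschitz n 1≤B hq hr) (expTerm-lipschitz (suc n) 1≤B hq hr) ⟩
  ∣ q - r ∣ * expSum n (B + B) + ∣ q - r ∣ * expTerm (B + B) (suc n)
    ≡⟨ *-distribˡ-+ ∣ q - r ∣ (expSum n (B + B)) (expTerm (B + B) (suc n)) ⟨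
  ∣ q - r ∣ * (expSum n (B + B) + expTerm (B + B) (suc n)) ∎
  where
  open ≤-Reasoning
  eq : ∀ a b c d → (a + b) - (c + d) ≡ (a - c) + (b - d)
  eq = +-*-Solver.solve 4 (λ a b c d → (a :+ b) :- (c :+ d) := (a :- c) :+ (b :- d)) refl
    where open +-*-Solver

-- From here on projections replace  with : abstracting over a goal that mentions
-- expSum normalises 1/! n, which is very slow.
cauchy-expSum : ∀ D → 0ℚ ≤ D → Cauchy (λ n → expSum n D)
cauchy-expSum D D≥0 = cauchy-ordered (λ n → expSum n D) λ ε ε>0 →
  proj₁ (expSum-tail→0 {D} D≥0 ε ε>0) , λ m n N≤m m≤n →
    ≤-<-trans {∣ expSum n D - expSum m D ∣} {expSum n D - expSum m D} {ε}
      (expSum-tail {D} {D} {m} {n} (≤-reflexive (0≤p⇒∣p∣≡p {D} D≥0)) m≤n)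
      (proj₂ (expSum-tail→0 {D} D≥0 ε ε>0) m n N≤m m≤n)

cauchy-exp : ∀ s → Cauchy s → Cauchy (λ n → expSum n (s n))
cauchy-exp s cs = cauchy-ordered (λ n → expSum n (s n)) λ ε ε>0 → N ε ε>0 , within ε ε>0
  where
  B D C : ℚ
  B = proj₁ (bounded s cs)
  D = B + B
  1≤B : 1ℚ ≤ B
  1≤B = proj₁ (proj₂ (bounded s cs))
  sB : ∀ n → ∣ s n ∣ ≤ B
  sB = proj₂ (proj₂ (bounded s cs))
  B≥0 : 0ℚ ≤ B
  B≥0 = ≤-trans {0ℚ} {1ℚ} {B} (<⇒≤ 0<1) 1≤B
  D≥0 : 0ℚ ≤ D
  D≥0 = +-nonneg {B} {B} B≥0 B≥0
  expSumBound : ∃ λ C → 1ℚ ≤ C × (∀ n → ∣ expSum n D ∣ ≤ C)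
  expSumBound = bounded (λ n → expSum n D) (cauchy-expSum D D≥0)
  C = proj₁ expSumBound
  expSum≤C : ∀ m → expSum m D ≤ C
  expSum≤C m = subst (_≤ C) (0≤p⇒∣p∣≡p {expSum m D} (expSum≥0 {D} m D≥0))
    (proj₂ (proj₂ expSumBound) m)
  module _ (ε : ℚ) (ε>0 : 0ℚ < ε) where
    tail : ∃ λ M → ∀ m n → M ℕ.≤ m → m ℕ.≤ n → expSum n B - expSum m B < ½ * ε
    tail = expSum-tail→0 {B} B≥0 (½ * ε) (half-pos {ε} ε>0)
    scaled : ∃ λ δ → 0ℚ < δ × (∀ {d} → d < δ → d * C < ½ * ε)
    scaled = scale C (½ * ε) (proj₁ (proj₂ expSumBound)) (half-pos {ε} ε>0)
    close : ∃ λ K → ∀ m n → K ℕ.≤ m → K ℕ.≤ n → ∣ s m - s n ∣ < proj₁ scaled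
    close = cs (proj₁ scaled) (proj₁ (proj₂ scaled))
    N : ℕ
    N = proj₁ tail ℕ.⊔ proj₁ close
    within : ∀ m n → N ℕ.≤ m → m ℕ.≤ n → ∣ expSum n (s n) - expSum m (s m) ∣ < ε
    within m n N≤m m≤n =
      dist-shrink {expSum n (s n)} {expSum m (s n)} {expSum m (s m)} {ε} truncation perturbation
      where
      K≤m : proj₁ close ℕ.≤ m
      K≤m = ℕ.m⊔n≤o⇒n≤o (proj₁ tail) (proj₁ close) N≤m
      d : ℚ
      d = ∣ s n - s m ∣
      truncation : ∣ expSum n (s n) - expSum m (s n) ∣ < ½ * ε
      truncation = ≤-<-trans {∣ expSum n (s n) - expSum m (s n) ∣} {expSum n B - expSum m B} {½ * ε}
        (expSum-tail {s n} {B} {m} {n} (sB n) m≤n)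
        (proj₂ tail m n (ℕ.m⊔n≤o⇒m≤o (proj₁ tail) (proj₁ close) N≤m) m≤n)
      perturbation : ∣ expSum m (s n) - expSum m (s m) ∣ < ½ * ε
      perturbation = ≤-<-trans {∣ expSum m (s n) - expSum m (s m) ∣} {d * expSum m D} {½ * ε}
        (expSum-lipschitz {B} {s n} {s m} m 1≤B (sB n) (sB m))
        (≤-<-trans {d * expSum m D} {d * C} {½ * ε}
          (*-monoˡ-≤-nonNeg d {{∣-∣-nonNeg (s n - s m)}} (expSum≤C m))
          (proj₂ (proj₂ scaled) {d} (proj₂ close n m (ℕ.≤-trans K≤m m≤n) K≤m)))

-- Reals are Cauchy sequences of rationals; equality of reals is _≈_, not _≡_.

record ℝ : Set where
  constructor mkℝ
  field
    seq    : ℕ → ℚ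
    cauchy : Cauchy seq

open ℝ public

infix  4 _≈_
infixl 6 _+ℝ_
infixl 7 _*ℝ_

_≈_ : ℝ → ℝ → Set
x ≈ y = ∀ ε → 0ℚ < ε → ∃ λ N → ∀ n → N ℕ.≤ n → ∣ seq x n - seq y n ∣ < ε

fromℚ : ℚ → ℝ
fromℚ q = mkℝ (λ _ → q) λ ε ε>0 → 0 , λ _ _ _ _ → subst (λ r → ∣ r ∣ < ε) (sym (+-inverseʳ q)) ε>0

0ℝ 1ℝ : ℝ
0ℝ = fromℚ 0ℚ
1ℝ = fromℚ 1ℚ

_+ℝ_ _*ℝ_ : ℝ → ℝ → ℝ
x +ℝ y = mkℝ (λ n → seq x n + seq y n) (cauchy-+ (seq x) (seq y) (cauchy x) (cauchy y))
x *ℝ y = mkℝ (λ n → seq x n * seq y n) (cauchy-* (seq x) (seq y) (cauchy x) (cauchy y))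

-ℝ_ : ℝ → ℝ
-ℝ x = mkℝ (λ n → - seq x n) (cauchy-neg (seq x) (cauchy x))

-- The real exponential, the limit of ∑_{j ≤ n} xʲ / j!.  Its n-th rational
-- approximation truncates the series at n and replaces x by its n-th approximation.
expℝ : ℝ → ℝ
expℝ x = mkℝ (λ n → expSum n (seq x n)) (cauchy-exp (seq x) (cauchy x))

∑≤ℝ : ℕ → (ℕ → ℝ) → ℝ
∑≤ℝ zero    f = f 0
∑≤ℝ (suc n) f = ∑≤ℝ n f +ℝ f (suc n)

-- A series is its sequence of coefficients; f n is the coefficient of xⁿ.
PowerSeries : Set
PowerSeries = ℕ → ℝ

infix  4 _≋_
infixl 6 _⊖_
infixl 7 _⊗_
infixr 8 _^^_

_≋_ : PowerSeries → PowerSeries → Set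
f ≋ g = ∀ n → f n ≈ g n

𝟘 𝟙 X : PowerSeries
𝟘 n             = 0ℝ
𝟙 zero          = 1ℝ
𝟙 (suc n)       = 0ℝ
X zero          = 0ℝ
X (suc zero)    = 1ℝ
X (suc (suc n)) = 0ℝ

⊖_ : PowerSeries → PowerSeries
(⊖ f) n = -ℝ f n

_⊖_ _⊗_ : PowerSeries → PowerSeries → PowerSeries
(f ⊖ g) n = f n +ℝ -ℝ g n
(f ⊗ g) n = ∑≤ℝ n (λ i → f i *ℝ g (n ℕ.∸ i))

_^^_ : PowerSeries → ℕ → PowerSeries
f ^^ zero  = 𝟙
f ^^ suc m = f ⊗ (f ^^ m)

-- ∫ f is the antiderivative of f with constant term 0.
∫ : PowerSeries → PowerSeries
∫ f zero    = 0ℝ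
∫ f (suc n) = fromℚ (+ 1 / suc n) *ℝ f n

dropConstant : PowerSeries → PowerSeries
dropConstant f zero    = 0ℝ
dropConstant f (suc n) = f (suc n)

-- e^f = e^{f(0)} · ∑ₘ (f - f(0))ᵐ / m!.  As (f - f(0))ᵐ is divisible by xᵐ, the
-- coefficient of xⁿ only involves m ≤ n.
exp : PowerSeries → PowerSeries
exp f n = expℝ (f 0) *ℝ ∑≤ℝ n (λ m → fromℚ (1/! m) *ℝ (dropConstant f ^^ m) n)

E3-21 : ∀ {k} → Vec ℕ k → PowerSeries
E3-21 p n = fromℚ (_/_ (+ N3-21 p n) (n !) {{n !≢0}})

{-# OPTIONS --safe #-}

-- In a permutation σ n τ avoiding 3-21, the word σ avoids 3-21, and τ increases because n
-- precedes it; conversely, every such word avoids 3-21.  Choosing the set of letters of σ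
-- gives a(n + 1) = ∑ᵢ C(n, i) a(i), that is y′ = eˣ y for the exponential generating
-- function.  The word begins with a descent iff σ does, or σ is empty and τ is not, which
-- adds the inhomogeneous term eˣ - 1; variation of constants then yields the integral.
-- Both equations determine the coefficients one after the other.  Since the constant terms
-- of e^{eˣ} and e^{-eˣ} are real numbers, e · e⁻¹ = 1 has to be proved for Cauchy sequences.

module Submission where

open import Algebra.Bundles using (CommutativeRing)
import Algebra.Properties.CommutativeSemigroup as CommutativeSemigroupProperties
import Algebra.Properties.Ring as RingProperties
open import Data.Nat.Base as ℕ using (ℕ; zero; suc; _∸_; z≤n; s≤s; _≥_; _!)
open import Data.Nat.Induction using (<-rec)
import Data.Nat.Properties as ℕ
open import Data.Product.Base using (∃; _×_; _,_; proj₁; proj₂)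
open import Data.Sum.Base using (_⊎_; inj₁; inj₂)
open import Function.Base using (_∘_; id)
open import Level using (_⊔_)
import Relation.Binary.PropositionalEquality as ≡
open ≡ using (_≡_)
import Relation.Binary.Reasoning.Setoid as SetoidReasoning

-- Formal series are developed over an arbitrary commutative ring because they serve twice: over ℝ
-- for the generating functions, and over ℚ for the numerical exponential, whose terms qⁿ/n! are the
-- coefficients of e^{qx}. Series identities are reduced to the product rule by comparing
-- derivatives, so that binomial coefficients never appear explicitly.
--
-- The obstacle in e · e⁻¹ = 1 is that both factors are approximated by partial sums truncated at
-- the same n, and the product of two such sums is in general not 1.
--
-- The recursion on the maximum produces an explicit list of words. It is compared with the filtered
-- list of all words by mutual inclusion, both lists being free of duplicates.
--
-- For k ≥ 3 nothing is counted: the first three letters already form the pattern.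

-- ∑ᵢ C(n, i) h(i), by Pascal's rule.
binomialTransform : (ℕ → ℕ) → ℕ → ℕ
binomialTransform h zero    = h 0
binomialTransform h (suc n) = binomialTransform h n ℕ.+ binomialTransform (h ∘ suc) n

-- Its exponential generating function is eˣ - 1. It records whether any letter follows a maximum
-- that stands first.
positivity : ℕ → ℕ
positivity zero    = 0
positivity (suc _) = 1

-- Formal power series over a commutative ring.

module _ {c ℓ} (R : CommutativeRing c ℓ) where

  open CommutativeRing R

  -- ν n stands for n.  The sum is a parameter so that at ∑≤ℝ the product below is _⊗_.
  module FormalSeries
    (∑ : ℕ → (ℕ → Carrier) → Carrier)
    (∑-zero : ∀ f → ∑ 0 f ≈ f 0)
    (∑-suc : ∀ n f → ∑ (suc n) f ≈ ∑ n f + f (suc n))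
    (ν : ℕ → Carrier) (ν-zero : ν 0 ≈ 0#) (ν-suc : ∀ n → ν (suc n) ≈ 1# + ν n)
    where

    open RingProperties ring using (-‿distribˡ-*; -‿distribʳ-*)
    open CommutativeSemigroupProperties +-commutativeSemigroup
      using () renaming (interchange to +-interchange)
    open CommutativeSemigroupProperties *-commutativeSemigroup using (x∙yz≈y∙xz)
    open SetoidReasoning setoid

    Series : Set c
    Series = ℕ → Carrier

    infix  4 _≗_
    infixl 6 _⊕_
    infixl 7 _⊛_
    infixr 7 _•_

    _≗_ : Series → Series → Set ℓ
    f ≗ g = ∀ n → f n ≈ g n

    _⊕_ _⊛_ : Series → Series → Series
    (f ⊕ g) n = f n + g n
    (f ⊛ g) n = ∑ n (λ i → f i * g (n ∸ i))

    _•_ : Carrier → Series → Series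
    (x • f) n = x * f n

    tail : Series → Series
    tail f n = f (suc n)

    0ˢ 1ˢ : Series
    0ˢ n       = 0#
    1ˢ zero    = 1#
    1ˢ (suc n) = 0#

    ∑-cong : ∀ n {f g : Series} → (∀ i → i ℕ.≤ n → f i ≈ g i) → ∑ n f ≈ ∑ n g
    ∑-cong zero {f} {g} f≈g = trans (∑-zero f) (trans (f≈g 0 z≤n) (sym (∑-zero g)))
    ∑-cong (suc n) {f} {g} f≈g = begin
      ∑ (suc n) f        ≈⟨ ∑-suc n f ⟩
      ∑ n f + f (suc n)  ≈⟨ +-cong (∑-cong n (λ i i≤n → f≈g i (ℕ.m≤n⇒m≤1+n i≤n))) (f≈g (suc n) ℕ.≤-refl) ⟩
      ∑ n g + g (suc n)  ≈⟨ ∑-suc n g ⟨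
      ∑ (suc n) g        ∎

    ∑-distrib-+ : ∀ n (f g : Series) → ∑ n (f ⊕ g) ≈ ∑ n f + ∑ n g
    ∑-distrib-+ zero f g =
      trans (∑-zero (f ⊕ g)) (sym (+-cong (∑-zero f) (∑-zero g)))
    ∑-distrib-+ (suc n) f g = begin
      ∑ (suc n) (f ⊕ g)                            ≈⟨ ∑-suc n (f ⊕ g) ⟩
      ∑ n (f ⊕ g) + (f (suc n) + g (suc n))        ≈⟨ +-congʳ (∑-distrib-+ n f g) ⟩
      (∑ n f + ∑ n g) + (f (suc n) + g (suc n))    ≈⟨ +-interchange _ _ _ _ ⟩
      (∑ n f + f (suc n)) + (∑ n g + g (suc n))    ≈⟨ +-cong (∑-suc n f) (∑-suc n g) ⟨
      ∑ (suc n) f + ∑ (suc n) g                    ∎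

    ∑-distribˡ-* : ∀ n x (f : Series) → ∑ n (x • f) ≈ x * ∑ n f
    ∑-distribˡ-* zero x f = trans (∑-zero (x • f)) (*-congˡ (sym (∑-zero f)))
    ∑-distribˡ-* (suc n) x f = begin
      ∑ (suc n) (x • f)              ≈⟨ ∑-suc n (x • f) ⟩
      ∑ n (x • f) + x * f (suc n)    ≈⟨ +-congʳ (∑-distribˡ-* n x f) ⟩
      x * ∑ n f + x * f (suc n)      ≈⟨ distribˡ x (∑ n f) (f (suc n)) ⟨
      x * (∑ n f + f (suc n))        ≈⟨ *-congˡ (∑-suc n f) ⟨
      x * ∑ (suc n) f                ∎

    ∑-head : ∀ n (f : Series) → ∑ (suc n) f ≈ f 0 + ∑ n (tail f)
    ∑-head zero f = trans (∑-suc 0 f) (+-cong (∑-zero f) (sym (∑-zero (tail f))))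
    ∑-head (suc n) f = begin
      ∑ (suc (suc n)) f                          ≈⟨ ∑-suc (suc n) f ⟩
      ∑ (suc n) f + f (suc (suc n))              ≈⟨ +-congʳ (∑-head n f) ⟩
      (f 0 + ∑ n (tail f)) + f (suc (suc n))     ≈⟨ +-assoc _ _ _ ⟩
      f 0 + (∑ n (tail f) + f (suc (suc n)))     ≈⟨ +-congˡ (∑-suc n (tail f)) ⟨
      f 0 + ∑ (suc n) (tail f)                   ∎

    ⊛-zero : ∀ f g → (f ⊛ g) 0 ≈ f 0 * g 0
    ⊛-zero f g = ∑-zero _

    ⊛-sucˡ : ∀ f g n → (f ⊛ g) (suc n) ≈ f 0 * g (suc n) + (tail f ⊛ g) n
    ⊛-sucˡ f g n = ∑-head n _

    ⊛-sucʳ : ∀ f g n → (f ⊛ g) (suc n) ≈ (f ⊛ tail g) n + f (suc n) * g 0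
    ⊛-sucʳ f g n = trans (∑-suc n _) (+-cong
      (∑-cong n (λ i i≤n → *-congˡ (reflexive (≡.cong g (ℕ.+-∸-assoc 1 i≤n)))))
      (*-congˡ (reflexive (≡.cong g (ℕ.n∸n≡0 n)))))

    -- Coefficient n of a product reads only the coefficients up to n of its factors. Hence the
    -- differential equations below are triangular, and truncated sums may stand in for infinite
    -- ones.
    ⊛-cong-≤ : ∀ n {f f′ g g′} → (∀ i → i ℕ.≤ n → f i ≈ f′ i) → (∀ i → i ℕ.≤ n → g i ≈ g′ i) →
               (f ⊛ g) n ≈ (f′ ⊛ g′) n
    ⊛-cong-≤ n f≈f′ g≈g′ = ∑-cong n λ i i≤n → *-cong (f≈f′ i i≤n) (g≈g′ (n ∸ i) (ℕ.m∸n≤m n i))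

    ⊛-cong : ∀ {f f′ g g′} → f ≗ f′ → g ≗ g′ → f ⊛ g ≗ f′ ⊛ g′
    ⊛-cong f≗f′ g≗g′ n = ⊛-cong-≤ n (λ i _ → f≗f′ i) (λ i _ → g≗g′ i)

    ⊛-congˡ : ∀ f {g g′} → g ≗ g′ → f ⊛ g ≗ f ⊛ g′
    ⊛-congˡ f = ⊛-cong {f} (λ _ → refl)

    ⊛-congʳ : ∀ {f f′} g → f ≗ f′ → f ⊛ g ≗ f′ ⊛ g
    ⊛-congʳ g f≗f′ = ⊛-cong {g = g} f≗f′ (λ _ → refl)

    -- Splitting off the first term on one side matches splitting off the last on the other, so
    -- induction replaces the reversal of a sum.
    ⊛-comm : ∀ f g → f ⊛ g ≗ g ⊛ f
    ⊛-comm f g zero = trans (⊛-zero f g) (trans (*-comm (f 0) (g 0)) (sym (⊛-zero g f)))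
    ⊛-comm f g (suc n) = begin
      (f ⊛ g) (suc n)                    ≈⟨ ⊛-sucˡ f g n ⟩
      f 0 * g (suc n) + (tail f ⊛ g) n   ≈⟨ +-cong (*-comm _ _) (⊛-comm (tail f) g n) ⟩
      g (suc n) * f 0 + (g ⊛ tail f) n   ≈⟨ +-comm _ _ ⟩
      (g ⊛ tail f) n + g (suc n) * f 0   ≈⟨ ⊛-sucʳ g f n ⟨
      (g ⊛ f) (suc n)                    ∎

    ⊛-distribʳ : ∀ h f g → (f ⊕ g) ⊛ h ≗ (f ⊛ h) ⊕ (g ⊛ h)
    ⊛-distribʳ h f g n = trans (∑-cong n (λ i _ → distribʳ _ _ _)) (∑-distrib-+ n _ _)

    ⊛-distribˡ : ∀ h f g → h ⊛ (f ⊕ g) ≗ (h ⊛ f) ⊕ (h ⊛ g)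
    ⊛-distribˡ h f g n = trans (∑-cong n (λ i _ → distribˡ _ _ _)) (∑-distrib-+ n _ _)

    •-⊛ : ∀ x f g → (x • f) ⊛ g ≗ x • (f ⊛ g)
    •-⊛ x f g n = trans (∑-cong n (λ i _ → *-assoc _ _ _)) (∑-distribˡ-* n x _)

    ⊛-• : ∀ x f g → f ⊛ (x • g) ≗ x • (f ⊛ g)
    ⊛-• x f g n = trans (∑-cong n (λ i _ → x∙yz≈y∙xz _ _ _)) (∑-distribˡ-* n x _)

    -- Splitting off the constant term of `f` leaves the same claim for `tail f` in one degree less,
    -- which avoids interchanging a double sum.
    ⊛-assoc : ∀ f g h → (f ⊛ g) ⊛ h ≗ f ⊛ (g ⊛ h)
    ⊛-assoc f g h zero = begin
      ((f ⊛ g) ⊛ h) 0        ≈⟨ ⊛-zero (f ⊛ g) h ⟩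
      (f ⊛ g) 0 * h 0        ≈⟨ *-congʳ (⊛-zero f g) ⟩
      f 0 * g 0 * h 0        ≈⟨ *-assoc _ _ _ ⟩
      f 0 * (g 0 * h 0)      ≈⟨ *-congˡ (⊛-zero g h) ⟨
      f 0 * (g ⊛ h) 0        ≈⟨ ⊛-zero f (g ⊛ h) ⟨
      (f ⊛ (g ⊛ h)) 0        ∎
    ⊛-assoc f g h (suc n) = begin
      ((f ⊛ g) ⊛ h) (suc n)
        ≈⟨ ⊛-sucˡ (f ⊛ g) h n ⟩
      (f ⊛ g) 0 * h (suc n) + (tail (f ⊛ g) ⊛ h) n
        ≈⟨ +-cong (trans (*-congʳ (⊛-zero f g)) (*-assoc _ _ _)) (⊛-congʳ h (⊛-sucˡ f g) n) ⟩
      f 0 * (g 0 * h (suc n)) + ((f 0 • tail g ⊕ (tail f ⊛ g)) ⊛ h) n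
        ≈⟨ +-congˡ (⊛-distribʳ h (f 0 • tail g) (tail f ⊛ g) n) ⟩
      f 0 * (g 0 * h (suc n)) + (((f 0 • tail g) ⊛ h) n + ((tail f ⊛ g) ⊛ h) n)
        ≈⟨ +-congˡ (+-cong (•-⊛ (f 0) (tail g) h n) (⊛-assoc (tail f) g h n)) ⟩
      f 0 * (g 0 * h (suc n)) + (f 0 * (tail g ⊛ h) n + (tail f ⊛ (g ⊛ h)) n)
        ≈⟨ +-assoc _ _ _ ⟨
      f 0 * (g 0 * h (suc n)) + f 0 * (tail g ⊛ h) n + (tail f ⊛ (g ⊛ h)) n
        ≈⟨ +-congʳ (distribˡ _ _ _) ⟨
      f 0 * (g 0 * h (suc n) + (tail g ⊛ h) n) + (tail f ⊛ (g ⊛ h)) n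
        ≈⟨ +-congʳ (*-congˡ (⊛-sucˡ g h n)) ⟨
      f 0 * (g ⊛ h) (suc n) + (tail f ⊛ (g ⊛ h)) n
        ≈⟨ ⊛-sucˡ f (g ⊛ h) n ⟨
      (f ⊛ (g ⊛ h)) (suc n) ∎

    ⊛-zeroˡ : ∀ g → 0ˢ ⊛ g ≗ 0ˢ
    ⊛-zeroˡ g n = trans (∑-cong n (λ i _ → trans (zeroˡ _) (sym (zeroˡ _))))
      (trans (∑-distribˡ-* n 0# 0ˢ) (zeroˡ _))

    ⊛-identityˡ : ∀ g → 1ˢ ⊛ g ≗ g
    ⊛-identityˡ g zero    = trans (⊛-zero 1ˢ g) (*-identityˡ (g 0))
    ⊛-identityˡ g (suc n) = begin
      (1ˢ ⊛ g) (suc n)               ≈⟨ ⊛-sucˡ 1ˢ g n ⟩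
      1# * g (suc n) + (0ˢ ⊛ g) n    ≈⟨ +-cong (*-identityˡ _) (⊛-zeroˡ g n) ⟩
      g (suc n) + 0#                 ≈⟨ +-identityʳ _ ⟩
      g (suc n)                      ∎

    ⊛-negˡ : ∀ f g n → ((λ i → - f i) ⊛ g) n ≈ - (f ⊛ g) n
    ⊛-negˡ f g n = begin
      ((λ i → - f i) ⊛ g) n
        ≈⟨ ∑-cong n (λ i _ → trans (sym (-‿distribˡ-* _ _)) (trans (-‿cong (sym (*-identityˡ _))) (-‿distribˡ-* _ _))) ⟩
      ∑ n ((- 1#) • λ i → f i * g (n ∸ i))
        ≈⟨ ∑-distribˡ-* n (- 1#) _ ⟩
      - 1# * (f ⊛ g) n
        ≈⟨ trans (sym (-‿distribˡ-* _ _)) (-‿cong (*-identityˡ _)) ⟩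
      - (f ⊛ g) n ∎

    -- Natural numbers in the ring and formal differentiation.

    ν-homo-+ : ∀ m n → ν (m ℕ.+ n) ≈ ν m + ν n
    ν-homo-+ zero    n = sym (trans (+-congʳ ν-zero) (+-identityˡ (ν n)))
    ν-homo-+ (suc m) n = begin
      ν (suc m ℕ.+ n)      ≈⟨ ν-suc (m ℕ.+ n) ⟩
      1# + ν (m ℕ.+ n)     ≈⟨ +-congˡ (ν-homo-+ m n) ⟩
      1# + (ν m + ν n)     ≈⟨ +-assoc 1# (ν m) (ν n) ⟨
      1# + ν m + ν n       ≈⟨ +-congʳ (ν-suc m) ⟨
      ν (suc m) + ν n      ∎

    ν-1 : ν 1 ≈ 1#
    ν-1 = trans (ν-suc 0) (trans (+-congˡ ν-zero) (+-identityʳ 1#))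

    D : Series → Series
    D f n = ν (suc n) * f (suc n)

    D-cong : ∀ {f g} → f ≗ g → D f ≗ D g
    D-cong f≗g n = *-congˡ (f≗g (suc n))

    D-⊕ : ∀ f g → D (f ⊕ g) ≗ D f ⊕ D g
    D-⊕ f g n = distribˡ _ _ _

    D-• : ∀ x f → D (x • f) ≗ x • D f
    D-• x f n = x∙yz≈y∙xz _ _ _

    D-1ˢ : D 1ˢ ≗ 0ˢ
    D-1ˢ n = zeroʳ _

    -- The Euler operator x d/dx is easier to handle termwise than d/dx.
    D-⊛ : ∀ f g → D (f ⊛ g) ≗ (D f ⊛ g) ⊕ (f ⊛ D g)
    D-⊛ f g n = begin
      D (f ⊛ g) n
        ≈⟨ ∑-distribˡ-* (suc n) (ν (suc n)) _ ⟨
      ∑ (suc n) (λ i → ν (suc n) * (f i * g (suc n ∸ i)))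
        ≈⟨ ∑-cong (suc n) termwise ⟩
      ∑ (suc n) (λ i → θ f i * g (suc n ∸ i) + f i * θ g (suc n ∸ i))
        ≈⟨ ∑-distrib-+ (suc n) _ _ ⟩
      (θ f ⊛ g) (suc n) + (f ⊛ θ g) (suc n)
        ≈⟨ +-cong (⊛-sucˡ (θ f) g n) (⊛-sucʳ f (θ g) n) ⟩
      (θ f 0 * g (suc n) + (D f ⊛ g) n) + ((f ⊛ D g) n + f (suc n) * θ g 0)
        ≈⟨ +-cong (+-congʳ (trans (*-congʳ (trans (*-congʳ ν-zero) (zeroˡ _))) (zeroˡ _)))
                  (+-congˡ (trans (*-congˡ (trans (*-congʳ ν-zero) (zeroˡ _))) (zeroʳ _))) ⟩
      (0# + (D f ⊛ g) n) + ((f ⊛ D g) n + 0#)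
        ≈⟨ +-cong (+-identityˡ _) (+-identityʳ _) ⟩
      (D f ⊛ g) n + (f ⊛ D g) n ∎
      where
      θ : Series → Series
      θ h i = ν i * h i
      termwise : ∀ i → i ℕ.≤ suc n →
        ν (suc n) * (f i * g (suc n ∸ i)) ≈ θ f i * g (suc n ∸ i) + f i * θ g (suc n ∸ i)
      termwise i i≤1+n = begin
        ν (suc n) * (f i * g k)
          ≈⟨ *-congʳ (reflexive (≡.cong ν (ℕ.m+[n∸m]≡n i≤1+n))) ⟨
        ν (i ℕ.+ k) * (f i * g k)
          ≈⟨ *-congʳ (ν-homo-+ i k) ⟩
        (ν i + ν k) * (f i * g k)
          ≈⟨ distribʳ _ _ _ ⟩
        ν i * (f i * g k) + ν k * (f i * g k)
          ≈⟨ +-cong (sym (*-assoc _ _ _)) (x∙yz≈y∙xz _ _ _) ⟩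
        ν i * f i * g k + f i * (ν k * g k) ∎
        where
        k = suc n ∸ i

    -- Exponentials and linear differential equations.

    module WithInverses
      (1/ν : Series) (ν-inverse : ∀ n → ν (suc n) * 1/ν n ≈ 1#)
      -- `r n` stands for 1/n!, so `r` is the series of eˣ.
      (r : Series) (r-zero : r 0 ≈ 1#) (r-suc : ∀ n → r (suc n) * ν (suc n) ≈ r n)
      where

      ν-cancel : ∀ n {x y} → ν (suc n) * x ≈ ν (suc n) * y → x ≈ y
      ν-cancel n {x} {y} eq = begin
        x                          ≈⟨ step x ⟨
        1/ν n * (ν (suc n) * x)    ≈⟨ *-congˡ eq ⟩
        1/ν n * (ν (suc n) * y)    ≈⟨ step y ⟩
        y                          ∎
        where
        step : ∀ z → 1/ν n * (ν (suc n) * z) ≈ z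
        step z = trans (sym (*-assoc _ _ _))
          (trans (*-congʳ (trans (*-comm _ _) (ν-inverse n))) (*-identityˡ z))

      D-r : D r ≗ r
      D-r n = trans (*-comm _ _) (r-suc n)

      integral-unique : ∀ {f g} → f 0 ≈ g 0 → D f ≗ D g → f ≗ g
      integral-unique f₀≈g₀ Df≗Dg zero    = f₀≈g₀
      integral-unique f₀≈g₀ Df≗Dg (suc n) = ν-cancel n (Df≗Dg n)

      -- S = c · ∑ₘ gᵐ / m!, where g is f without its constant term and P m = gᵐ.  As
      -- r m = 1/m!, the coefficient of xⁿ only involves m ≤ n.
      record IsExp (f S : Series) : Set (c ⊔ ℓ) where
        field
          g      : Series
          g-zero : g 0 ≈ 0#
          g-suc  : ∀ n → g (suc n) ≈ f (suc n)
          P      : ℕ → Series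
          P-zero : P 0 ≗ 1ˢ
          P-suc  : ∀ m → P (suc m) ≗ g ⊛ P m
          const  : Carrier
          S-def  : ∀ n → S n ≈ const * ∑ n (λ m → r m * P m n)

        P-vanishes : ∀ m n → n ℕ.< m → P m n ≈ 0#
        P-vanishes (suc m) zero _ = begin
          P (suc m) 0      ≈⟨ P-suc m 0 ⟩
          (g ⊛ P m) 0      ≈⟨ ⊛-zero g (P m) ⟩
          g 0 * P m 0      ≈⟨ *-congʳ g-zero ⟩
          0# * P m 0       ≈⟨ zeroˡ _ ⟩
          0#               ∎
        P-vanishes (suc m) (suc n) (s≤s n<m) = begin
          P (suc m) (suc n)                        ≈⟨ P-suc m (suc n) ⟩
          (g ⊛ P m) (suc n)                        ≈⟨ ⊛-sucˡ g (P m) n ⟩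
          g 0 * P m (suc n) + (tail g ⊛ P m) n     ≈⟨ +-cong (trans (*-congʳ g-zero) (zeroˡ _)) lower ⟩
          0# + 0#                                  ≈⟨ +-identityˡ 0# ⟩
          0#                                       ∎
          where
          lower : (tail g ⊛ P m) n ≈ 0#
          lower = begin
            (tail g ⊛ P m) n  ≈⟨ ⊛-cong-≤ n (λ i _ → refl) (λ i i≤n → P-vanishes m i (ℕ.≤-<-trans i≤n n<m)) ⟩
            (tail g ⊛ 0ˢ) n   ≈⟨ ⊛-comm (tail g) 0ˢ n ⟩
            (0ˢ ⊛ tail g) n   ≈⟨ ⊛-zeroˡ (tail g) n ⟩
            0#                ∎

        -- The power rule, by induction with the product rule; `swap` moves g past g′ to rebuild the
        -- next power.
        D-P : ∀ m → D (P (suc m)) ≗ ν (suc m) • (D g ⊛ P m)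
        D-P zero n = begin
          D (P 1) n                        ≈⟨ D-cong (P-suc 0) n ⟩
          D (g ⊛ P 0) n                    ≈⟨ D-⊛ g (P 0) n ⟩
          (D g ⊛ P 0) n + (g ⊛ D (P 0)) n  ≈⟨ +-congˡ (⊛-congˡ g (λ i → trans (D-cong P-zero i) (D-1ˢ i)) n) ⟩
          (D g ⊛ P 0) n + (g ⊛ 0ˢ) n       ≈⟨ +-congˡ (trans (⊛-comm g 0ˢ n) (⊛-zeroˡ g n)) ⟩
          (D g ⊛ P 0) n + 0#               ≈⟨ +-identityʳ _ ⟩
          (D g ⊛ P 0) n                    ≈⟨ *-identityˡ _ ⟨
          1# * (D g ⊛ P 0) n               ≈⟨ *-congʳ ν-1 ⟨
          ν 1 * (D g ⊛ P 0) n              ∎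
        D-P (suc m) n = begin
          D (P (suc (suc m))) n
            ≈⟨ D-cong (P-suc (suc m)) n ⟩
          D (g ⊛ P (suc m)) n
            ≈⟨ D-⊛ g (P (suc m)) n ⟩
          (D g ⊛ P (suc m)) n + (g ⊛ D (P (suc m))) n
            ≈⟨ +-congˡ (⊛-congˡ g (D-P m) n) ⟩
          (D g ⊛ P (suc m)) n + (g ⊛ (ν (suc m) • (D g ⊛ P m))) n
            ≈⟨ +-congˡ (⊛-• (ν (suc m)) g (D g ⊛ P m) n) ⟩
          (D g ⊛ P (suc m)) n + ν (suc m) * (g ⊛ (D g ⊛ P m)) n
            ≈⟨ +-congˡ (*-congˡ swap) ⟩
          (D g ⊛ P (suc m)) n + ν (suc m) * (D g ⊛ P (suc m)) n
            ≈⟨ +-congʳ (*-identityˡ _) ⟨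
          1# * (D g ⊛ P (suc m)) n + ν (suc m) * (D g ⊛ P (suc m)) n
            ≈⟨ distribʳ _ _ _ ⟨
          (1# + ν (suc m)) * (D g ⊛ P (suc m)) n
            ≈⟨ *-congʳ (ν-suc (suc m)) ⟨
          ν (suc (suc m)) * (D g ⊛ P (suc m)) n ∎
          where
          swap : (g ⊛ (D g ⊛ P m)) n ≈ (D g ⊛ P (suc m)) n
          swap = begin
            (g ⊛ (D g ⊛ P m)) n    ≈⟨ ⊛-assoc g (D g) (P m) n ⟨
            ((g ⊛ D g) ⊛ P m) n    ≈⟨ ⊛-congʳ (P m) (⊛-comm g (D g)) n ⟩
            ((D g ⊛ g) ⊛ P m) n    ≈⟨ ⊛-assoc (D g) g (P m) n ⟩
            (D g ⊛ (g ⊛ P m)) n    ≈⟨ ⊛-congˡ (D g) (P-suc m) n ⟨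
            (D g ⊛ P (suc m)) n    ∎

        -- The number N of the last term and the degree n are decoupled: differentiation lowers N by
        -- one in all degrees at once, whereas `S` is a multiple of the diagonal of this family.
        partial : ℕ → Series
        partial N n = ∑ N (λ m → r m * P m n)

        partial-suc : ∀ N → partial (suc N) ≗ partial N ⊕ r (suc N) • P (suc N)
        partial-suc N n = ∑-suc N _

        partial-truncate : ∀ N n → n ℕ.≤ N → partial N n ≈ partial n n
        partial-truncate zero    zero _ = refl
        partial-truncate (suc N) n n≤1+N with ℕ.m≤n⇒m<n∨m≡n n≤1+N
        ... | inj₂ ≡.refl = refl
        ... | inj₁ (s≤s n≤N) = begin
          partial (suc N) n                       ≈⟨ partial-suc N n ⟩
          partial N n + r (suc N) * P (suc N) n   ≈⟨ +-congˡ (trans (*-congˡ (P-vanishes (suc N) n (s≤s n≤N))) (zeroʳ _)) ⟩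
          partial N n + 0#                        ≈⟨ +-identityʳ _ ⟩
          partial N n                             ≈⟨ partial-truncate N n n≤N ⟩
          partial n n                             ∎

        D-term : ∀ m → D (r (suc m) • P (suc m)) ≗ r m • (D g ⊛ P m)
        D-term m n = begin
          D (r (suc m) • P (suc m)) n                    ≈⟨ D-• (r (suc m)) (P (suc m)) n ⟩
          r (suc m) * D (P (suc m)) n                    ≈⟨ *-congˡ (D-P m n) ⟩
          r (suc m) * (ν (suc m) * (D g ⊛ P m) n)        ≈⟨ *-assoc _ _ _ ⟨
          r (suc m) * ν (suc m) * (D g ⊛ P m) n          ≈⟨ *-congʳ (r-suc m) ⟩
          r m * (D g ⊛ P m) n                            ∎

        D-partial : ∀ N → D (partial (suc N)) ≗ D g ⊛ partial N
        D-partial zero n = begin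
          D (partial 1) n
            ≈⟨ D-cong (partial-suc 0) n ⟩
          D (partial 0 ⊕ r 1 • P 1) n
            ≈⟨ D-⊕ (partial 0) (r 1 • P 1) n ⟩
          D (partial 0) n + D (r 1 • P 1) n
            ≈⟨ +-cong constant (D-term 0 n) ⟩
          0# + r 0 * (D g ⊛ P 0) n
            ≈⟨ +-identityˡ _ ⟩
          r 0 * (D g ⊛ P 0) n
            ≈⟨ ⊛-• (r 0) (D g) (P 0) n ⟨
          (D g ⊛ (r 0 • P 0)) n
            ≈⟨ ⊛-congˡ (D g) (λ i → ∑-zero (λ m → r m * P m i)) n ⟨
          (D g ⊛ partial 0) n ∎
          where
          constant : D (partial 0) n ≈ 0#
          constant = trans (*-congˡ (trans (∑-zero _) (trans (*-congˡ (P-zero (suc n))) (zeroʳ _)))) (zeroʳ _)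
        D-partial (suc N) n = begin
          D (partial (suc (suc N))) n
            ≈⟨ D-cong (partial-suc (suc N)) n ⟩
          D (partial (suc N) ⊕ r (suc (suc N)) • P (suc (suc N))) n
            ≈⟨ D-⊕ (partial (suc N)) (r (suc (suc N)) • P (suc (suc N))) n ⟩
          D (partial (suc N)) n + D (r (suc (suc N)) • P (suc (suc N))) n
            ≈⟨ +-cong (D-partial N n) (D-term (suc N) n) ⟩
          (D g ⊛ partial N) n + r (suc N) * (D g ⊛ P (suc N)) n
            ≈⟨ +-congˡ (⊛-• (r (suc N)) (D g) (P (suc N)) n) ⟨
          (D g ⊛ partial N) n + (D g ⊛ (r (suc N) • P (suc N))) n
            ≈⟨ ⊛-distribˡ (D g) (partial N) (r (suc N) • P (suc N)) n ⟨
          (D g ⊛ (partial N ⊕ r (suc N) • P (suc N))) n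
            ≈⟨ ⊛-congˡ (D g) (partial-suc N) n ⟨
          (D g ⊛ partial (suc N)) n ∎

        D-exp : D S ≗ D f ⊛ S
        D-exp n = begin
          ν (suc n) * S (suc n)                       ≈⟨ *-congˡ (S-def (suc n)) ⟩
          ν (suc n) * (const * partial (suc n) (suc n))   ≈⟨ x∙yz≈y∙xz _ _ _ ⟩
          const * D (partial (suc n)) n                   ≈⟨ *-congˡ (D-partial n n) ⟩
          -- The product reads `partial n` only in degrees up to n, where it agrees with the
          -- diagonal.
          const * (D g ⊛ partial n) n                     ≈⟨ *-congˡ (⊛-cong-≤ n (λ _ _ → refl) (partial-truncate n)) ⟩
          const * (D g ⊛ (λ i → partial i i)) n           ≈⟨ ⊛-• const (D g) (λ i → partial i i) n ⟨
          (D g ⊛ (const • λ i → partial i i)) n           ≈⟨ ⊛-cong (λ i → *-congˡ (sym (g-suc i))) S-def n ⟨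
          (D f ⊛ S) n                                 ∎

      -- Exponential generating functions and the equations they satisfy.

      egf : (ℕ → ℕ) → Series
      egf a n = r n * ν (a n)

      D-egf : ∀ a → D (egf a) ≗ egf (a ∘ suc)
      D-egf a n = trans (sym (*-assoc _ _ _)) (*-congʳ (D-r n))

      -- For A the series of `a`, the product rule gives (eˣ A)′ = eˣ A + eˣ A′, and A′ is the
      -- series of the shifted sequence. This is precisely Pascal's rule in the recursion of
      -- `binomialTransform`.
      r⊛egf : ∀ a → r ⊛ egf a ≗ egf (binomialTransform a)
      r⊛egf a zero = begin
        (r ⊛ egf a) 0          ≈⟨ ⊛-zero r (egf a) ⟩
        r 0 * egf a 0          ≈⟨ *-congʳ r-zero ⟩
        1# * egf a 0           ≈⟨ *-identityˡ _ ⟩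
        egf a 0                ∎
      r⊛egf a (suc n) = ν-cancel n (begin
        D (r ⊛ egf a) n
          ≈⟨ D-⊛ r (egf a) n ⟩
        (D r ⊛ egf a) n + (r ⊛ D (egf a)) n
          ≈⟨ +-cong (⊛-congʳ (egf a) D-r n) (⊛-congˡ r (D-egf a) n) ⟩
        (r ⊛ egf a) n + (r ⊛ egf (a ∘ suc)) n
          ≈⟨ +-cong (r⊛egf a n) (r⊛egf (a ∘ suc) n) ⟩
        r n * ν (binomialTransform a n) + r n * ν (binomialTransform (a ∘ suc) n)
          ≈⟨ distribˡ _ _ _ ⟨
        r n * (ν (binomialTransform a n) + ν (binomialTransform (a ∘ suc) n))
          ≈⟨ *-congˡ (ν-homo-+ (binomialTransform a n) _) ⟨
        egf (binomialTransform a ∘ suc) n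
          ≈⟨ D-egf (binomialTransform a) n ⟨
        D (egf (binomialTransform a)) n ∎)

      -- The recurrence for `a` is the equation y′ = eˣ y + B read coefficientwise, with B the
      -- series of `b`. Coefficient n of eˣ y involves all earlier coefficients of y, hence complete
      -- induction. Both nonzero cases use it, with B = 0 and B = eˣ - 1.
      egf-unique : ∀ {a b : ℕ → ℕ} {f} → (∀ n → a (suc n) ≡ binomialTransform a n ℕ.+ b n) →
                   f 0 ≈ ν (a 0) → D f ≗ (r ⊛ f) ⊕ egf b → f ≗ egf a
      egf-unique {a} {b} {f} a-suc f₀ Df = <-rec (λ n → f n ≈ egf a n) step
        where
        step : ∀ n → (∀ {i} → i ℕ.< n → f i ≈ egf a i) → f n ≈ egf a n
        step zero    _  = trans f₀ (sym (trans (*-congʳ r-zero) (*-identityˡ _)))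
        step (suc n) ih = ν-cancel n (begin
          D f n
            ≈⟨ Df n ⟩
          (r ⊛ f) n + egf b n
            ≈⟨ +-congʳ (⊛-cong-≤ n (λ _ _ → refl) (λ i i≤n → ih (s≤s i≤n))) ⟩
          (r ⊛ egf a) n + egf b n
            ≈⟨ +-congʳ (r⊛egf a n) ⟩
          r n * ν (binomialTransform a n) + r n * ν (b n)
            ≈⟨ distribˡ _ _ _ ⟨
          r n * (ν (binomialTransform a n) + ν (b n))
            ≈⟨ *-congˡ (ν-homo-+ (binomialTransform a n) (b n)) ⟨
          r n * ν (binomialTransform a n ℕ.+ b n)
            ≈⟨ *-congˡ (reflexive (≡.cong ν (a-suc n))) ⟨
          egf (a ∘ suc) n
            ≈⟨ D-egf a n ⟨
          D (egf a) n ∎)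

      constant≈1⇒inverse : ∀ {f g h} → D f ≗ h ⊛ f → D g ≗ (λ n → - h n) ⊛ g → f 0 * g 0 ≈ 1# → f ⊛ g ≗ 1ˢ
      constant≈1⇒inverse {f} {g} {h} Df Dg f₀g₀ =
        integral-unique (trans (⊛-zero f g) f₀g₀) λ n → begin
          D (f ⊛ g) n
            ≈⟨ D-⊛ f g n ⟩
          (D f ⊛ g) n + (f ⊛ D g) n
            ≈⟨ +-cong (⊛-congʳ g Df n) (⊛-congˡ f Dg n) ⟩
          ((h ⊛ f) ⊛ g) n + (f ⊛ ((λ i → - h i) ⊛ g)) n
            ≈⟨ +-congˡ (⊛-congˡ f (⊛-negˡ h g) n) ⟩
          ((h ⊛ f) ⊛ g) n + (f ⊛ (λ i → - (h ⊛ g) i)) n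
            ≈⟨ +-congˡ (trans (⊛-comm f _ n) (trans (⊛-negˡ (h ⊛ g) f n) (-‿cong (⊛-assoc h g f n)))) ⟩
          ((h ⊛ f) ⊛ g) n + - (h ⊛ (g ⊛ f)) n
            ≈⟨ +-cong (⊛-assoc h f g n) (-‿cong (⊛-congˡ h (⊛-comm g f) n)) ⟩
          (h ⊛ (f ⊛ g)) n + - (h ⊛ (f ⊛ g)) n
            ≈⟨ -‿inverseʳ _ ⟩
          0#
            ≈⟨ D-1ˢ n ⟨
          D 1ˢ n ∎

      -- The product rule turns f y′ into f g k, and g is the inverse of f.
      variation-of-parameters : ∀ {f g h k y} → D f ≗ h ⊛ f → f ⊛ g ≗ 1ˢ → D y ≗ g ⊛ k →
                                D (f ⊛ y) ≗ (h ⊛ (f ⊛ y)) ⊕ k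
      variation-of-parameters {f} {g} {h} {k} {y} Df fg≗1 Dy n = begin
        D (f ⊛ y) n                              ≈⟨ D-⊛ f y n ⟩
        (D f ⊛ y) n + (f ⊛ D y) n                ≈⟨ +-cong (⊛-congʳ y Df n) (⊛-congˡ f Dy n) ⟩
        ((h ⊛ f) ⊛ y) n + (f ⊛ (g ⊛ k)) n        ≈⟨ +-cong (⊛-assoc h f y n) (sym (⊛-assoc f g k n)) ⟩
        (h ⊛ (f ⊛ y)) n + ((f ⊛ g) ⊛ k) n        ≈⟨ +-congˡ (trans (⊛-congʳ k fg≗1 n) (⊛-identityˡ k n)) ⟩
        (h ⊛ (f ⊛ y)) n + k n                    ∎

      -- Here h is the derivative of the exponent. This identifies eˣ, defined through powers of x,
      -- with the series of the 1/n!.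
      exponential-unique : ∀ {f h} → h ≗ 1ˢ → D f ≗ h ⊛ f → f 0 ≈ 1# → f ≗ r
      exponential-unique h≗1 Df f₀ zero    = trans f₀ (sym r-zero)
      exponential-unique {f} {h} h≗1 Df f₀ (suc n) = ν-cancel n (begin
        D f n          ≈⟨ Df n ⟩
        (h ⊛ f) n      ≈⟨ ⊛-congʳ f h≗1 n ⟩
        (1ˢ ⊛ f) n     ≈⟨ ⊛-identityˡ f n ⟩
        f n            ≈⟨ exponential-unique {f} {h} h≗1 Df f₀ n ⟩
        r n            ≈⟨ D-r n ⟨
        D r n          ∎)

      egf-0 : egf (λ _ → 0) ≗ 0ˢ
      egf-0 n = trans (*-congˡ ν-zero) (zeroʳ (r n))

      -- `x`, `e` and `k` stand for x, eˣ and eˣ - 1. As `k` and `e` differ at most in the constant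
      -- term, they have the same derivative.
      module _ {x e : Series} (x₁ : x 1 ≈ 1#) (x₂ : ∀ n → x (suc (suc n)) ≈ 0#)
        (e-exp : IsExp x e) (e₀ : e 0 ≈ 1#) {k : Series} (k-suc : ∀ n → k (suc n) ≈ e (suc n))
        where

        open IsExp using (D-exp)

        D-x : D x ≗ 1ˢ
        D-x zero    = trans (*-cong ν-1 x₁) (*-identityˡ 1#)
        D-x (suc n) = trans (*-congˡ (x₂ n)) (zeroʳ _)

        e≗r : e ≗ r
        e≗r = exponential-unique {h = D x} D-x (D-exp e-exp) e₀

        D-e : D e ≗ r
        D-e n = trans (D-cong e≗r n) (D-r n)

        exp[eˣ-1] : ∀ {z a} → IsExp k z → z 0 ≈ ν (a 0) →
                    (∀ n → a (suc n) ≡ binomialTransform a n) → ∀ n → z n ≈ r n * ν (a n)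
        exp[eˣ-1] {z} {a} z-exp z₀ a-suc = egf-unique {b = λ _ → 0}
          (λ n → ≡.trans (a-suc n) (≡.sym (ℕ.+-identityʳ _))) z₀ λ n → begin
            D z n                             ≈⟨ D-exp z-exp n ⟩
            (D k ⊛ z) n                       ≈⟨ ⊛-congʳ z (λ i → trans (*-congˡ (k-suc i)) (D-e i)) n ⟩
            (r ⊛ z) n                         ≈⟨ +-identityʳ _ ⟨
            (r ⊛ z) n + 0#                    ≈⟨ +-congˡ (egf-0 n) ⟨
            (r ⊛ z) n + egf (λ _ → 0) n       ∎

        -- The product is written out: at ℝ, converting it to _⊗_ via _⊛_ unfolds the arithmetic of ℚ.
        variation-of-constants : ∀ {e⁻ f g y a} → k 0 ≈ 0# → (∀ n → e⁻ n ≈ - e n) →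
          IsExp e f → IsExp e⁻ g → f 0 * g 0 ≈ 1# →
          y 0 ≈ 0# → (∀ n → y (suc n) ≈ 1/ν n * ∑ n (λ i → g i * k (n ∸ i))) →
          a 0 ≡ 0 → (∀ n → a (suc n) ≡ binomialTransform a n ℕ.+ positivity n) →
          ∀ n → ∑ n (λ i → f i * y (n ∸ i)) ≈ r n * ν (a n)
        variation-of-constants {e⁻} {f} {g} {y} {a} k₀ e⁻-def f-exp g-exp f₀g₀ y₀ y-suc a₀ a-suc =
          egf-unique {b = positivity} {f ⊛ y} a-suc fy₀ λ n → begin
            D (f ⊛ y) n
              ≈⟨ variation-of-parameters {f} {g} {D e} {k} {y} (D-exp f-exp) fg≗1 D-y n ⟩
            (D e ⊛ (f ⊛ y)) n + k n
              ≈⟨ +-cong (⊛-congʳ (f ⊛ y) D-e n) (k≗egf n) ⟩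
            (r ⊛ (f ⊛ y)) n + egf positivity n ∎
          where
          D-g : D g ≗ (λ i → - D e i) ⊛ g
          D-g n = trans (D-exp g-exp n) (⊛-congʳ g
            (λ i → trans (*-congˡ (e⁻-def (suc i))) (sym (-‿distribʳ-* _ _))) n)
          fg≗1 : f ⊛ g ≗ 1ˢ
          fg≗1 = constant≈1⇒inverse {f} {g} {D e} (D-exp f-exp) D-g f₀g₀
          D-y : D y ≗ g ⊛ k
          D-y n = begin
            ν (suc n) * y (suc n)                  ≈⟨ *-congˡ (y-suc n) ⟩
            ν (suc n) * (1/ν n * (g ⊛ k) n)        ≈⟨ *-assoc _ _ _ ⟨
            ν (suc n) * 1/ν n * (g ⊛ k) n          ≈⟨ *-congʳ (ν-inverse n) ⟩
            1# * (g ⊛ k) n                         ≈⟨ *-identityˡ _ ⟩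
            (g ⊛ k) n                              ∎
          k≗egf : k ≗ egf positivity
          k≗egf zero    = trans k₀ (sym (egf-0 0))
          k≗egf (suc n) = trans (k-suc n) (trans (e≗r (suc n)) (sym (trans (*-congˡ ν-1) (*-identityʳ _))))
          fy₀ : (f ⊛ y) 0 ≈ ν (a 0)
          fy₀ = trans (⊛-zero f y) (trans (*-congˡ y₀) (trans (zeroʳ _)
            (sym (trans (reflexive (≡.cong ν a₀)) ν-zero))))

open import Defs
open import Data.Vec.Base as Vec using (Vec; []; _∷_; lookup; toList)
open ≡ using (refl; sym; trans; cong; cong₂; subst; setoid; module ≡-Reasoning)

-- Counting the permutations.

module Counts where

  open import Data.Fin.Base as Fin using (Fin; zero; suc; toℕ; fromℕ<)
  import Data.Fin.Properties as Fin
  open import Data.List.Base using (List; []; _∷_; [_]; _++_; _∷ʳ_; map; concatMap; filter; length; downFrom)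
  import Data.List.Properties as List
  open import Data.List.Membership.Propositional using (_∈_; _∉_; find; lose)
  open import Data.List.Membership.Propositional.Properties
    using (∈-map⁺; ∈-map⁻; ∈-++⁺ˡ; ∈-++⁺ʳ; ∈-++⁻; ∈-∃++; ∈-filter⁺; ∈-filter⁻; ∈-concatMap⁺; ∈-concatMap⁻;
           ∈-cartesianProductWith⁺; ∈-allFin)
  open import Data.List.Relation.Binary.Disjoint.Propositional using (Disjoint)
  open import Data.List.Relation.Binary.Permutation.Propositional
    using (_↭_; prep; ↭⇒↭ₛ; ↭-refl; ↭-reflexive; ↭-sym; ↭-trans)
  open import Data.List.Relation.Binary.Permutation.Propositional.Properties
    using (All-resp-↭; ∈-resp-↭; ↭-length; shift; drop-mid; ++⁺ʳ; ↭-empty-inv; ∷↭∷ʳ)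
  import Data.List.Relation.Binary.Permutation.Setoid.Properties as ↭-Setoid
  open import Data.List.Relation.Binary.Subset.Propositional using (_⊆_)
  open import Data.List.Relation.Unary.All as All using (All; []; _∷_)
  import Data.List.Relation.Unary.All.Properties as All
  open import Data.List.Relation.Unary.AllPairs as AllPairs using (AllPairs; []; _∷_)
  import Data.List.Relation.Unary.AllPairs.Properties as AllPairs
  open import Data.List.Relation.Unary.Any using (here; there)
  open import Data.List.Relation.Unary.Linked as Linked using (Linked; []; [-]; _∷_)
  import Data.List.Relation.Unary.Linked.Properties as Linked
  open import Data.List.Relation.Unary.Unique.Propositional using (Unique)
  import Data.List.Relation.Unary.Unique.Propositional.Properties as Unique
  open import Data.Nat.Base using (_+_; _≤_; _<_; _>_)
  open import Data.Nat.ListAction using (sum)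
  open import Data.Nat.ListAction.Properties using (sum-++)
  open import Data.Nat.Properties
  open import Data.Unit.Base using (⊤; tt)
  import Data.Vec.Relation.Unary.All as VecAll
  import Data.Vec.Relation.Unary.AllPairs as VecAllPairs
  open import Data.Vec.Relation.Unary.Unique.Propositional using () renaming (Unique to VecUnique)
  open import Function.Bundles using (_⇔_; mk⇔; module Equivalence)
  open Equivalence using (to; from)
  open import Relation.Nullary.Decidable using (yes; no; map′; _×-dec_; from-yes; from-no)
  open import Relation.Nullary.Negation using (¬_; contradiction)
  open import Relation.Unary using (Decidable)

  private variable
    A B C : Set

  -- Deleting the letters of `xs` from `ys` one at a time leaves the complement `zs`. Both
  -- pigeonhole principles below come from the length of `zs`.
  unique-⊆⇒extends : {xs ys : List A} → Unique xs → xs ⊆ ys → ∃ λ zs → xs ++ zs ↭ ys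
  unique-⊆⇒extends {xs = []}     {ys} _ _ = ys , ↭-refl
  unique-⊆⇒extends {xs = x ∷ xs} (x∉xs ∷ u) xs⊆ys with ∈-∃++ (xs⊆ys (here refl))
  ... | ys₁ , ys₂ , refl with unique-⊆⇒extends u sub
    where
    sub : xs ⊆ ys₁ ++ ys₂
    sub {y} y∈xs with ∈-++⁻ ys₁ (xs⊆ys (there y∈xs))
    ... | inj₁ y∈ys₁         = ∈-++⁺ˡ y∈ys₁
    ... | inj₂ (here refl)   = contradiction refl (All.lookup x∉xs y∈xs)
    ... | inj₂ (there y∈ys₂) = ∈-++⁺ʳ ys₁ y∈ys₂
  ... | zs , p = zs , ↭-trans (prep x p) (↭-sym (shift x ys₁ ys₂))

  unique-⊆⇒length≤ : {xs ys : List A} → Unique xs → xs ⊆ ys → length xs ≤ length ys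
  unique-⊆⇒length≤ {xs = xs} u xs⊆ys with unique-⊆⇒extends u xs⊆ys
  ... | zs , p = subst (length xs ≤_) (trans (sym (List.length-++ xs)) (↭-length p)) (m≤m+n (length xs) (length zs))

  unique-⊆⇒↭ : {xs ys : List A} → Unique xs → xs ⊆ ys → length xs ≡ length ys → xs ↭ ys
  unique-⊆⇒↭ {xs = xs} u xs⊆ys len with unique-⊆⇒extends u xs⊆ys
  ... | []     , p = subst (_↭ _) (List.++-identityʳ xs) p
  ... | z ∷ zs , p = contradiction
    (trans len (sym (trans (sym (List.length-++ xs)) (↭-length p))))
    (<⇒≢ (m<m+n (length xs) (s≤s z≤n)))

  -- A common element of two blocks forces their keys to agree, and the keys are pairwise distinct,
  -- so the blocks are disjoint.
  concatMap-unique : ∀ (f : A → List B) (key : A → C) xs → Unique (map key xs) →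
    (∀ {x} → x ∈ xs → Unique (f x)) →
    (∀ {x y b} → x ∈ xs → y ∈ xs → b ∈ f x → b ∈ f y → key x ≡ key y) →
    Unique (concatMap f xs)
  concatMap-unique f key []       _        _  _   = []
  concatMap-unique f key (x ∷ xs) (x∉ ∷ u) uf sep = Unique.++⁺ (uf (here refl))
    (concatMap-unique f key xs u (uf ∘ there) (λ x∈ y∈ → sep (there x∈) (there y∈)))
    λ { (b∈fx , b∈rest) → let y , y∈ , b∈fy = find (∈-concatMap⁻ f b∈rest) in
        All.lookup x∉ (∈-map⁺ key y∈) (sep (here refl) (there y∈) b∈fx b∈fy) }

  ++-∷-injective : ∀ {v : A} σ σ′ {τ τ′} → v ∉ σ → v ∉ σ′ → σ ++ v ∷ τ ≡ σ′ ++ v ∷ τ′ → σ ≡ σ′ × τ ≡ τ′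
  ++-∷-injective []      []        _   _    eq = refl , List.∷-injectiveʳ eq
  ++-∷-injective []      (x ∷ σ′)  _   v∉σ′ eq = contradiction (here (List.∷-injectiveˡ eq)) v∉σ′
  ++-∷-injective (x ∷ σ) []        v∉σ _    eq = contradiction (here (sym (List.∷-injectiveˡ eq))) v∉σ
  ++-∷-injective (x ∷ σ) (x′ ∷ σ′) v∉σ v∉σ′ eq with List.∷-injective eq
  ... | refl , eq′ with ++-∷-injective σ σ′ (v∉σ ∘ there) (v∉σ′ ∘ there) eq′
  ... | refl , refl = refl , refl

  -- Distributing a decreasing list over the two sides of its maximum.

  -- All ways to distribute a list over two, the second of which is reversed.
  splits : List A → List (List A × List A)
  splits []      = [ ([] , []) ]
  splits (x ∷ L) = map (λ (S , T) → S , T ∷ʳ x) (splits L) ++ map (λ (S , T) → x ∷ S , T) (splits L)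

  ∈-splits-∷ : ∀ {x : A} {L S T} → (S , T) ∈ splits (x ∷ L) →
    (∃ λ T′ → (S , T′) ∈ splits L × T ≡ T′ ∷ʳ x) ⊎ (∃ λ S′ → (S′ , T) ∈ splits L × S ≡ x ∷ S′)
  ∈-splits-∷ {L = L} s∈ with ∈-++⁻ (map _ (splits L)) s∈
  ... | inj₁ p with ∈-map⁻ _ p
  ...   | (S , T′) , q , refl = inj₁ (T′ , q , refl)
  ∈-splits-∷ {L = L} s∈ | inj₂ p with ∈-map⁻ _ p
  ...   | (S′ , T) , q , refl = inj₂ (S′ , q , refl)

  ∷ʳ-∈-splits : ∀ {x : A} {L S T} → (S , T) ∈ splits L → (S , T ∷ʳ x) ∈ splits (x ∷ L)
  ∷ʳ-∈-splits s∈ = ∈-++⁺ˡ (∈-map⁺ _ s∈)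

  ∷-∈-splits : ∀ {x : A} {L S T} → (S , T) ∈ splits L → (x ∷ S , T) ∈ splits (x ∷ L)
  ∷-∈-splits {L = L} s∈ = ∈-++⁺ʳ (map _ (splits L)) (∈-map⁺ _ s∈)

  splits-↭ : ∀ (L : List A) {S T} → (S , T) ∈ splits L → S ++ T ↭ L
  splits-↭ []      (here refl) = ↭-refl
  splits-↭ (x ∷ L) s∈ with ∈-splits-∷ {L = L} s∈
  ... | inj₂ (S′ , p , refl) = prep x (splits-↭ L p)
  ... | inj₁ (T′ , p , refl) = ↭-trans
    (↭-trans (↭-reflexive (sym (List.++-assoc _ T′ [ x ]))) (↭-sym (∷↭∷ʳ x _)))
    (prep x (splits-↭ L p))

  module _ {P : ℕ → Set} where

    splits-Allˡ : ∀ {L S T} → All P L → (S , T) ∈ splits L → All P S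
    splits-Allˡ {L} {S} all s∈ = All.++⁻ˡ S (All-resp-↭ (↭-sym (splits-↭ L s∈)) all)

    splits-Allʳ : ∀ {L S T} → All P L → (S , T) ∈ splits L → All P T
    splits-Allʳ {L} {S} all s∈ = All.++⁻ʳ S (All-resp-↭ (↭-sym (splits-↭ L s∈)) all)

  Decreasing Increasing : List ℕ → Set
  Decreasing = AllPairs _>_
  Increasing = AllPairs _≤_

  splits-decreasing : ∀ {L S T} → Decreasing L → (S , T) ∈ splits L → Decreasing S
  splits-decreasing []            (here refl) = []
  splits-decreasing {x ∷ L} (x> ∷ d) s∈ with ∈-splits-∷ {L = L} s∈
  ... | inj₁ (T′ , p , refl) = splits-decreasing d p
  ... | inj₂ (S′ , p , refl) = splits-Allˡ x> p ∷ splits-decreasing d p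

  -- The reversal in `splits` pays off here: the largest letter sent to the right is appended last.
  splits-increasing : ∀ {L S T} → Decreasing L → (S , T) ∈ splits L → Increasing T
  splits-increasing []            (here refl) = []
  splits-increasing {x ∷ L} (x> ∷ d) s∈ with ∈-splits-∷ {L = L} s∈
  ... | inj₁ (T′ , p , refl) = AllPairs.++⁺ (splits-increasing d p) ([] ∷ [])
    (All.map (λ y<x → <⇒≤ y<x ∷ []) (splits-Allʳ x> p))
  ... | inj₂ (S′ , p , refl) = splits-increasing d p

  -- The head x is the maximum of the list. If it lies in σ, it is removed there, since σ matters
  -- only up to rearrangement; if it lies in τ, it must be the last letter, since τ increases.
  splits-complete : ∀ {L} σ τ → Decreasing L → σ ++ τ ↭ L → Increasing τ → ∃ λ S → (S , τ) ∈ splits L × σ ↭ S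
  splits-complete {[]} σ τ _ p inc with ↭-empty-inv p
  splits-complete {[]} [] [] _ p inc | refl = [] , here refl , ↭-refl
  splits-complete {x ∷ L} σ τ (x> ∷ d) p inc with ∈-++⁻ σ (∈-resp-↭ (↭-sym p) (here refl))
  ... | inj₁ x∈σ with ∈-∃++ x∈σ
  ... | σ₁ , σ₂ , refl
    with splits-complete (σ₁ ++ σ₂) τ d
      (↭-trans (↭-reflexive (List.++-assoc σ₁ σ₂ τ))
        (drop-mid σ₁ [] (↭-trans (↭-reflexive (sym (List.++-assoc σ₁ (x ∷ σ₂) τ))) p))) inc
  ... | S , s∈ , q = x ∷ S , ∷-∈-splits {L = L} s∈ , ↭-trans (shift x σ₁ σ₂) (prep x q)
  splits-complete {x ∷ L} σ τ (x> ∷ d) p inc | inj₂ x∈τ with ∈-∃++ x∈τ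
  ... | τ₁ , τ₂ , refl = go τ₂ p inc
    where
    go : ∀ τ₂ → σ ++ τ₁ ++ x ∷ τ₂ ↭ x ∷ L → Increasing (τ₁ ++ x ∷ τ₂) →
         ∃ λ S → (S , τ₁ ++ x ∷ τ₂) ∈ splits (x ∷ L) × σ ↭ S
    go τ₂ p inc with drop-mid (σ ++ τ₁) [] (↭-trans (↭-reflexive (List.++-assoc σ τ₁ (x ∷ τ₂))) p)
    go [] p inc | q
      with splits-complete σ τ₁ d (subst (_↭ L) (List.++-identityʳ (σ ++ τ₁)) q) (prefix τ₁ inc)
      where
      prefix : ∀ τ₁ {τ₂} → Increasing (τ₁ ++ τ₂) → Increasing τ₁
      prefix []       _        = []
      prefix (y ∷ τ₁) (a ∷ ps) = All.++⁻ˡ τ₁ a ∷ prefix τ₁ ps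
    ... | S , s∈ , r = S , ∷ʳ-∈-splits {L = L} s∈ , r
    -- A letter y behind x would be smaller than the maximum x and yet at least x.
    go (y ∷ τ₂) p inc | q = contradiction (head≤ τ₁ inc) (<⇒≱ y<x)
      where
      y<x : y < x
      y<x = All.lookup x> (∈-resp-↭ q (∈-++⁺ʳ (σ ++ τ₁) (here refl)))
      head≤ : ∀ τ₁ → Increasing (τ₁ ++ x ∷ y ∷ τ₂) → x ≤ y
      head≤ []       ((x≤y ∷ _) ∷ _) = x≤y
      head≤ (_ ∷ τ₁) (_ ∷ ps)        = head≤ τ₁ ps

  -- The right part alone determines the split: whether it contains x tells the two halves of
  -- `splits` apart.
  splits-unique : {L : List A} → Unique L → Unique (map proj₂ (splits L))
  splits-unique {L = []}    _ = [] ∷ []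
  splits-unique {L = x ∷ L} (x∉ ∷ u) = subst Unique (sym eq)
    (Unique.++⁺ (Unique.map⁺ (λ {T} {T′} → List.∷ʳ-injectiveˡ T T′) (splits-unique u)) (splits-unique u) disjoint)
    where
    ss : List (List _ × List _)
    ss = splits L
    eq : map proj₂ (splits (x ∷ L)) ≡ map (_∷ʳ x) (map proj₂ ss) ++ map proj₂ ss
    eq = trans (List.map-++ proj₂ (map _ ss) (map _ ss))
      (cong₂ _++_ (trans (sym (List.map-∘ ss)) (List.map-∘ ss)) (sym (List.map-∘ ss)))
    disjoint : Disjoint (map (_∷ʳ x) (map proj₂ ss)) (map proj₂ ss)
    disjoint (p , q) with ∈-map⁻ (_∷ʳ x) p | ∈-map⁻ proj₂ q
    ... | T , _ , refl | (S , _) , s∈ , refl =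
      All.lookup x∉ (∈-resp-↭ (splits-↭ L s∈) (∈-++⁺ʳ S (∈-++⁺ʳ T (here refl)))) refl

  -- Pascal's rule again: sending x to the right keeps the size of the left part, sending it to the
  -- left raises the size by one.
  splits-sum : ∀ (h : ℕ → ℕ) (L : List A) → sum (map (h ∘ length ∘ proj₁) (splits L)) ≡ binomialTransform h (length L)
  splits-sum h []      = +-identityʳ (h 0)
  splits-sum h (x ∷ L) = begin
    sum (map (h ∘ length ∘ proj₁) (splits (x ∷ L)))
      ≡⟨ cong sum (List.map-++ (h ∘ length ∘ proj₁) (map _ ss) (map _ ss)) ⟩
    sum (map (h ∘ length ∘ proj₁) (map _ ss) ++ map (h ∘ length ∘ proj₁) (map _ ss))
      ≡⟨ cong sum (cong₂ _++_ (sym (List.map-∘ ss)) (sym (List.map-∘ ss))) ⟩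
    sum (map (h ∘ length ∘ proj₁) ss ++ map (h ∘ suc ∘ length ∘ proj₁) ss)
      ≡⟨ sum-++ (map (h ∘ length ∘ proj₁) ss) (map (h ∘ suc ∘ length ∘ proj₁) ss) ⟩
    sum (map (h ∘ length ∘ proj₁) ss) + sum (map (h ∘ suc ∘ length ∘ proj₁) ss)
      ≡⟨ cong₂ _+_ (splits-sum h L) (splits-sum (h ∘ suc) L) ⟩
    binomialTransform h (length L) + binomialTransform (h ∘ suc) (length L) ∎
    where
    open ≡-Reasoning
    ss : List (List _ × List _)
    ss = splits L

  -- Pattern avoidance for words.

  NoDescentBelow : ℕ → List ℕ → Set
  NoDescentBelow a = Linked (λ b c → b < a → b ≤ c)

  -- The letter `a` plays the 3. Since `Linked` compares neighbours only, b and c play the adjacent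
  -- 2 and 1, and recursion lets every letter take its turn as the 3.
  data Avoiding : List ℕ → Set where
    []  : Avoiding []
    _∷_ : ∀ {a w} → NoDescentBelow a w → Avoiding w → Avoiding (a ∷ w)

  module _ {R : ℕ → ℕ → Set} where

    Linked-++⁻ˡ : ∀ xs {ys} → Linked R (xs ++ ys) → Linked R xs
    Linked-++⁻ˡ []           _       = []
    Linked-++⁻ˡ (x ∷ [])     _       = [-]
    Linked-++⁻ˡ (x ∷ y ∷ xs) (r ∷ l) = r ∷ Linked-++⁻ˡ (y ∷ xs) l

    Linked-++⁺ : ∀ {xs y ys} → Linked R xs → All (λ x → R x y) xs → Linked R (y ∷ ys) → Linked R (xs ++ y ∷ ys)
    Linked-++⁺ []      _        l′ = l′
    Linked-++⁺ [-]     (r ∷ []) l′ = r ∷ l′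
    Linked-++⁺ (r ∷ l) (_ ∷ rs) l′ = r ∷ Linked-++⁺ l rs l′

  increasing⇒avoiding : ∀ {τ} → Linked _≤_ τ → Avoiding τ
  increasing⇒avoiding {[]}    _ = []
  increasing⇒avoiding {x ∷ τ} l = Linked.map (λ b≤c _ → b≤c) (Linked.tail l) ∷ increasing⇒avoiding (Linked.tail l)

  -- The step from σ to v is an ascent, τ has no descents, and a descent starting at v is harmless
  -- behind letters of σ, because v exceeds them all and cannot play the 2.
  avoiding-++⁺ : ∀ {σ v τ} → All (_< v) σ → Avoiding σ → Linked _≤_ τ → Avoiding (σ ++ v ∷ τ)
  avoiding-++⁺ [] [] inc = Linked.map (λ b≤c _ → b≤c) inc ∷ increasing⇒avoiding inc
  avoiding-++⁺ {a ∷ σ} {v} {τ} (a<v ∷ σ<v) (nd ∷ av) inc =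
    Linked-++⁺ nd (All.map (λ b<v _ → <⇒≤ b<v) σ<v) (after τ inc) ∷ avoiding-++⁺ σ<v av inc
    where
    after : ∀ τ → Linked _≤_ τ → NoDescentBelow a (v ∷ τ)
    after []      _ = [-]
    after (t ∷ τ) l = (λ v<a → contradiction v<a (<⇒≯ a<v)) ∷ Linked.map (λ b≤c _ → b≤c) l

  avoiding-++⁻ : ∀ σ {v τ} → All (_< v) τ → Avoiding (σ ++ v ∷ τ) → Avoiding σ × Linked _≤_ τ
  avoiding-++⁻ []      τ<v (nd ∷ _) = [] , increasing τ<v nd
    where
    increasing : ∀ {v τ} → All (_< v) τ → NoDescentBelow v τ → Linked _≤_ τ
    increasing _           []       = []
    increasing _           [-]      = [-]
    increasing (b<v ∷ all) (nd ∷ l) = nd b<v ∷ increasing all l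
  avoiding-++⁻ (a ∷ σ) τ<v (nd ∷ av) with avoiding-++⁻ σ τ<v av
  ... | av-σ , inc = Linked-++⁻ˡ σ nd ∷ av-σ , inc

  -- Enumeration of the avoiding words.

  -- The arrangements of a decreasing list that avoid 3-21: what precedes the maximum v
  -- avoids 3-21, and what follows it increases.  m is fuel, at least the length of the list.
  avoiders : ℕ → List ℕ → List (List ℕ)
  avoiders m       []      = [ [] ]
  avoiders zero    (v ∷ L) = []
  avoiders (suc m) (v ∷ L) = concatMap (λ (S , T) → map (λ σ → σ ++ v ∷ T) (avoiders m S)) (splits L)

  avoiders-∈⁻ : ∀ m {v L w} → w ∈ avoiders (suc m) (v ∷ L) →
    ∃ λ S → ∃ λ T → ∃ λ σ → (S , T) ∈ splits L × σ ∈ avoiders m S × w ≡ σ ++ v ∷ T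
  avoiders-∈⁻ m {L = L} w∈ with find (∈-concatMap⁻ _ {xs = splits L} w∈)
  ... | (S , T) , s∈ , p with ∈-map⁻ _ p
  ... | σ , σ∈ , refl = S , T , σ , s∈ , σ∈ , refl

  avoiders-sound : ∀ m {L w} → Decreasing L → w ∈ avoiders m L → w ↭ L × Avoiding w
  avoiders-sound m       {[]}    _        (here refl) = ↭-refl , []
  avoiders-sound (suc m) {v ∷ L} (v> ∷ d) w∈ with avoiders-∈⁻ m {v} {L} w∈
  ... | S , T , σ , s∈ , σ∈ , refl with avoiders-sound m (splits-decreasing d s∈) σ∈
  ... | σ↭S , av =
    ↭-trans (shift v σ T) (prep v (↭-trans (++⁺ʳ T σ↭S) (splits-↭ L s∈))) ,
    avoiding-++⁺ (All-resp-↭ (↭-sym σ↭S) (splits-Allˡ v> s∈)) av (Linked.AllPairs⇒Linked (splits-increasing d s∈))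

  avoiders-complete : ∀ m {L w} → length L ≤ m → Decreasing L → w ↭ L → Avoiding w → w ∈ avoiders m L
  avoiders-complete m {[]} _ _ p _ = here (↭-empty-inv p)
  avoiders-complete (suc m) {v ∷ L} (s≤s len) (v> ∷ d) p av with ∈-∃++ (∈-resp-↭ (↭-sym p) (here refl))
  ... | σ , τ , refl = result
    where
    q : σ ++ τ ↭ L
    q = drop-mid σ [] p
    τ<v : All (_< v) τ
    τ<v = All.++⁻ʳ σ (All-resp-↭ (↭-sym q) v>)
    result : σ ++ v ∷ τ ∈ avoiders (suc m) (v ∷ L)
    result with avoiding-++⁻ σ τ<v av
    ... | av-σ , inc with splits-complete σ τ d q (Linked.Linked⇒AllPairs ≤-trans inc)
    ... | S , s∈ , σ↭S = ∈-concatMap⁺ _ (lose s∈ (∈-map⁺ (λ σ → σ ++ v ∷ τ)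
      (avoiders-complete m (≤-trans S≤L len) (splits-decreasing d s∈) σ↭S av-σ)))
      where
      S≤L : length S ≤ length L
      S≤L = subst (length S ≤_) (trans (sym (List.length-++ S)) (↭-length (splits-↭ L s∈))) (m≤m+n (length S) _)

  decreasing⇒unique : ∀ {L} → Decreasing L → Unique L
  decreasing⇒unique = AllPairs.map (λ x>y x≡y → <-irrefl (sym x≡y) x>y)

  -- The maximum v occurs once in a word, so its position determines σ and T; T in turn determines
  -- the split and serves as the key.
  avoiders-unique : ∀ m {L} → Decreasing L → Unique (avoiders m L)
  avoiders-unique m       {[]}    _ = [] ∷ []
  avoiders-unique zero    {v ∷ L} _ = []
  avoiders-unique (suc m) {v ∷ L} (v> ∷ d) =
    concatMap-unique _ proj₂ (splits L) (splits-unique (decreasing⇒unique d))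
      (λ {(S , T)} s∈ → Unique.map⁺ (λ {σ} {σ′} → List.++-cancelʳ (v ∷ T) σ σ′) (avoiders-unique m (splits-decreasing d s∈)))
      separate
    where
    v∉ : ∀ {S T σ} → (S , T) ∈ splits L → σ ∈ avoiders m S → v ∉ σ
    v∉ s∈ σ∈ v∈σ = <-irrefl refl
      (All.lookup (splits-Allˡ v> s∈) (∈-resp-↭ (proj₁ (avoiders-sound m (splits-decreasing d s∈) σ∈)) v∈σ))
    separate : ∀ {x y b} → x ∈ splits L → y ∈ splits L →
      b ∈ map (λ σ → σ ++ v ∷ proj₂ x) (avoiders m (proj₁ x)) →
      b ∈ map (λ σ → σ ++ v ∷ proj₂ y) (avoiders m (proj₁ y)) → proj₂ x ≡ proj₂ y
    separate x∈ y∈ p q with ∈-map⁻ _ p | ∈-map⁻ _ q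
    ... | σ , σ∈ , refl | σ′ , σ′∈ , eq = proj₂ (++-∷-injective σ σ′ (v∉ x∈ σ∈) (v∉ y∈ σ′∈) eq)

  -- The recurrence for the number of avoiding words with a given beginning.

  binomialTransform-cong : ∀ n {h h′} → (∀ i → i ≤ n → h i ≡ h′ i) → binomialTransform h n ≡ binomialTransform h′ n
  binomialTransform-cong zero    h≡h′ = h≡h′ 0 z≤n
  binomialTransform-cong (suc n) h≡h′ = cong₂ _+_
    (binomialTransform-cong n (λ i i≤n → h≡h′ i (m≤n⇒m≤1+n i≤n)))
    (binomialTransform-cong n (λ i i≤n → h≡h′ (suc i) (s≤s i≤n)))

  -- Only the summand with i = 0 changes, and its weight is C(n, 0) = 1.
  binomialTransform-shift₀ : ∀ n {h h′ x} → h′ 0 ≡ h 0 + x → (∀ i → h′ (suc i) ≡ h (suc i)) →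
    binomialTransform h′ n ≡ binomialTransform h n + x
  binomialTransform-shift₀ zero    h₀ _ = h₀
  binomialTransform-shift₀ (suc n) {h} {h′} {x} h₀ h₊ = begin
    binomialTransform h′ n + binomialTransform (h′ ∘ suc) n
      ≡⟨ cong₂ _+_ (binomialTransform-shift₀ n {h} {h′} h₀ h₊) (binomialTransform-cong n (λ i _ → h₊ i)) ⟩
    binomialTransform h n + x + binomialTransform (h ∘ suc) n
      ≡⟨ trans (+-assoc (binomialTransform h n) x _) (trans (cong (binomialTransform h n +_) (+-comm x _))
           (sym (+-assoc (binomialTransform h n) _ x))) ⟩
    binomialTransform h n + binomialTransform (h ∘ suc) n + x ∎
    where open ≡-Reasoning

  ∈-map-cong : ∀ {f g : A → B} xs → (∀ {x} → x ∈ xs → f x ≡ g x) → map f xs ≡ map g xs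
  ∈-map-cong xs eq = List.map-cong-local (All.tabulate eq)

  module _ {Q : B → Set} (Q? : Decidable Q) where

    length-filter-concatMap : ∀ (f : A → List B) xs →
      length (filter Q? (concatMap f xs)) ≡ sum (map (length ∘ filter Q? ∘ f) xs)
    length-filter-concatMap f []       = refl
    length-filter-concatMap f (x ∷ xs) = trans (cong length (List.filter-++ Q? (f x) (concatMap f xs)))
      (trans (List.length-++ (filter Q? (f x))) (cong (length (filter Q? (f x)) +_) (length-filter-concatMap f xs)))

  length-filter-map : ∀ {P : A → Set} {Q : B → Set} (P? : Decidable P) (Q? : Decidable Q) (f : A → B) xs →
    (∀ {x} → x ∈ xs → Q (f x) ⇔ P x) → length (filter Q? (map f xs)) ≡ length (filter P? xs)
  length-filter-map P? Q? f []       _  = refl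
  length-filter-map P? Q? f (x ∷ xs) eq with P? x | Q? (f x)
  ... | yes p | yes q = cong suc (length-filter-map P? Q? f xs (eq ∘ there))
  ... | no ¬p | no ¬q = length-filter-map P? Q? f xs (eq ∘ there)
  ... | yes p | no ¬q = contradiction (from (eq (here refl)) p) ¬q
  ... | no ¬p | yes q = contradiction (to (eq (here refl)) q) ¬p

  -- The common part of the two counts. `Q` looks at the beginning of a word: once some letter
  -- precedes the maximum v, appending v and T does not affect it. When v comes first, `c` is the
  -- deviation from the count for the empty word, and it depends only on the length of T.
  module Counting {Q : List ℕ → Set} (Q? : Decidable Q) (c : ℕ → ℕ)
    (Q-extend : ∀ {s σ v T} → All (_< v) (s ∷ σ) → Q (s ∷ σ ++ v ∷ T) ⇔ Q (s ∷ σ))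
    (Q-max-first : ∀ {v T} → All (_< v) T →
       length (filter Q? [ v ∷ T ]) ≡ length (filter Q? [ [] ]) + c (length T))
    where

    -- The first argument mirrors the fuel of `avoiders`. It makes the recursion structural although
    -- the transform needs all earlier values.
    count : ℕ → ℕ → ℕ
    count m       zero    = length (filter Q? [ [] ])
    count zero    (suc n) = 0
    count (suc m) (suc n) = binomialTransform (count m) n + c n

    count-fuel : ∀ {m m′} n → n ≤ m → n ≤ m′ → count m n ≡ count m′ n
    count-fuel zero    _ _ = refl
    count-fuel (suc n) (s≤s n≤m) (s≤s n≤m′) = cong (_+ c n)
      (binomialTransform-cong n (λ i i≤n → count-fuel i (≤-trans i≤n n≤m) (≤-trans i≤n n≤m′)))

    avoiders-count : ∀ m {L} → Decreasing L → length (filter Q? (avoiders m L)) ≡ count m (length L)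
    avoiders-count m       {[]}    _ = refl
    avoiders-count zero    {v ∷ L} _ = refl
    avoiders-count (suc m) {v ∷ L} (v> ∷ d) = begin
      length (filter Q? (avoiders (suc m) (v ∷ L)))
        ≡⟨ length-filter-concatMap Q? _ (splits L) ⟩
      sum (map (λ (S , T) → length (filter Q? (map (λ σ → σ ++ v ∷ T) (avoiders m S)))) (splits L))
        ≡⟨ cong sum (∈-map-cong (splits L) block) ⟩
      sum (map (h ∘ length ∘ proj₁) (splits L))
        ≡⟨ splits-sum h L ⟩
      binomialTransform h (length L)
        ≡⟨ binomialTransform-shift₀ (length L) {count m} {h} refl (λ _ → refl) ⟩
      binomialTransform (count m) (length L) + c (length L) ∎
      where
      open ≡-Reasoning
      -- The correction sits at index 0, where S is empty and T therefore contains all of `L`.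
      h : ℕ → ℕ
      h zero    = count m 0 + c (length L)
      h (suc i) = count m (suc i)
      block : ∀ {s} → s ∈ splits L →
        length (filter Q? (map (λ σ → σ ++ v ∷ proj₂ s) (avoiders m (proj₁ s)))) ≡ h (length (proj₁ s))
      block {[] , T}    s∈ = trans (Q-max-first (splits-Allʳ v> s∈))
        (cong (λ k → length (filter Q? [ [] ]) + c k) (↭-length (splits-↭ L s∈)))
      block {s ∷ S , T} s∈ = trans
        (length-filter-map Q? Q? (λ σ → σ ++ v ∷ T) (avoiders m (s ∷ S)) extend)
        (avoiders-count m (splits-decreasing d s∈))
        where
        extend : ∀ {σ} → σ ∈ avoiders m (s ∷ S) → Q (σ ++ v ∷ T) ⇔ Q σ
        extend {σ} σ∈ with σ | proj₁ (avoiders-sound m (splits-decreasing d s∈) σ∈)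
        ... | []    | p = contradiction (↭-length p) 0≢1+n
        ... | x ∷ σ | p = Q-extend (All-resp-↭ (↭-sym p) (splits-Allˡ v> s∈))

    avoiders-count-suc : ∀ n → count (suc n) (suc n) ≡ binomialTransform (λ i → count i i) n + c n
    avoiders-count-suc n = cong (_+ c n) (binomialTransform-cong n (λ i i≤n → count-fuel i i≤n ≤-refl))

  -- From vectors over a finite type to words of natural numbers.

  values : ∀ {n m} → Vec (Fin n) m → List ℕ
  values = toList ∘ Vec.map toℕ

  values-injective : ∀ {n m} (π ρ : Vec (Fin n) m) → values π ≡ values ρ → π ≡ ρ
  values-injective []      []      _  = refl
  values-injective (x ∷ π) (y ∷ ρ) eq with List.∷-injective eq
  ... | x≡y , eq′ = cong₂ _∷_ (Fin.toℕ-injective x≡y) (values-injective π ρ eq′)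

  values-All : ∀ {n m} {P : ℕ → Set} {π : Vec (Fin n) m} → VecAll.All (P ∘ toℕ) π ⇔ All P (values π)
  values-All = mk⇔ to′ from′
    where
    to′ : ∀ {n m} {P : ℕ → Set} {π : Vec (Fin n) m} → VecAll.All (P ∘ toℕ) π → All P (values π)
    to′ VecAll.[]       = []
    to′ (p VecAll.∷ ps) = p ∷ to′ ps
    from′ : ∀ {n m} {P : ℕ → Set} {π : Vec (Fin n) m} → All P (values π) → VecAll.All (P ∘ toℕ) π
    from′ {π = []}    _        = VecAll.[]
    from′ {π = _ ∷ _} (p ∷ ps) = p VecAll.∷ from′ ps

  values-unique : ∀ {n m} {π : Vec (Fin n) m} → VecUnique π ⇔ Unique (values π)
  values-unique = mk⇔ to′ from′
    where
    to′ : ∀ {n m} {π : Vec (Fin n) m} → VecUnique π → Unique (values π)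
    to′ VecAllPairs.[]        = []
    to′ (x∉ VecAllPairs.∷ u) = to values-All (VecAll.map (λ x≢y → x≢y ∘ Fin.toℕ-injective) x∉) ∷ to′ u
    from′ : ∀ {n m} {π : Vec (Fin n) m} → Unique (values π) → VecUnique π
    from′ {π = []}    _        = VecAllPairs.[]
    from′ {π = _ ∷ _} (x∉ ∷ u) = VecAll.map (λ x≢y → x≢y ∘ cong toℕ) (from values-All x∉) VecAllPairs.∷ from′ u

  values-< : ∀ {n m} (π : Vec (Fin n) m) → All (_< n) (values π)
  values-< []      = []
  values-< (x ∷ π) = Fin.toℕ<n x ∷ values-< π

  length-values : ∀ {n m} (π : Vec (Fin n) m) → length (values π) ≡ m
  length-values []      = refl
  length-values (x ∷ π) = cong suc (length-values π)

  values-surjective : ∀ {n w} → All (_< n) w → ∃ λ (π : Vec (Fin n) (length w)) → values π ≡ w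
  values-surjective []          = [] , refl
  values-surjective (x<n ∷ all) = let π , eq = values-surjective all in
    fromℕ< x<n ∷ π , cong₂ _∷_ (Fin.toℕ-fromℕ< x<n) eq

  ∈-downFrom : ∀ {n x} → x < n → x ∈ downFrom n
  ∈-downFrom {suc n} {x} (s≤s x≤n) with m≤n⇒m<n∨m≡n x≤n
  ... | inj₁ x<n  = there (∈-downFrom x<n)
  ... | inj₂ refl = here refl

  downFrom-< : ∀ n → All (_< n) (downFrom n)
  downFrom-< zero    = []
  downFrom-< (suc n) = ≤-refl ∷ All.map m<n⇒m<1+n (downFrom-< n)

  downFrom-decreasing : ∀ n → Decreasing (downFrom n)
  downFrom-decreasing zero    = []
  downFrom-decreasing (suc n) = downFrom-< n ∷ downFrom-decreasing n

  isPermutation⇔↭ : ∀ {n} {π : Vec (Fin n) n} → IsPermutation π ⇔ (values π ↭ downFrom n)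
  isPermutation⇔↭ {n} {π} = mk⇔
    (λ u → unique-⊆⇒↭ (to values-unique u) (λ x∈ → ∈-downFrom (All.lookup (values-< π) x∈))
      (trans (length-values π) (sym (List.length-downFrom n))))
    (λ p → from values-unique (↭-Setoid.Unique-resp-↭ (setoid ℕ) (↭⇒↭ₛ (↭-sym p)) (Unique.downFrom⁺ n)))

  -- The alphabet size n is separate from the length m, so that an induction can drop the first
  -- letter and keep the alphabet.
  NoPattern : ∀ {n m} → Vec (Fin n) m → Set
  NoPattern π = ∀ i j j⁺ → i Fin.< j → toℕ j⁺ ≡ suc (toℕ j) →
    lookup π j Fin.< lookup π i → lookup π j Fin.≤ lookup π j⁺

  noDescentBelow⇔ : ∀ {n m} {a} (π : Vec (Fin n) m) → NoDescentBelow a (values π) ⇔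
    (∀ j j⁺ → toℕ j⁺ ≡ suc (toℕ j) → toℕ (lookup π j) < a → lookup π j Fin.≤ lookup π j⁺)
  noDescentBelow⇔ π = mk⇔ (to′ π) (from′ π)
    where
    to′ : ∀ {n m a} (π : Vec (Fin n) m) → NoDescentBelow a (values π) →
      ∀ j j⁺ → toℕ j⁺ ≡ suc (toℕ j) → toℕ (lookup π j) < a → lookup π j Fin.≤ lookup π j⁺
    to′ (x ∷ y ∷ π) (r ∷ l) zero    (suc zero) eq = r
    to′ (x ∷ y ∷ π) (r ∷ l) (suc j) (suc j⁺)       eq = to′ (y ∷ π) l j j⁺ (suc-injective eq)
    from′ : ∀ {n m a} (π : Vec (Fin n) m) →
      (∀ j j⁺ → toℕ j⁺ ≡ suc (toℕ j) → toℕ (lookup π j) < a → lookup π j Fin.≤ lookup π j⁺) →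
      NoDescentBelow a (values π)
    from′ []          _ = []
    from′ (x ∷ [])    _ = [-]
    from′ (x ∷ y ∷ π) f = f zero (suc zero) refl ∷
      from′ (y ∷ π) (λ j j⁺ eq → f (suc j) (suc j⁺) (cong suc eq))

  avoiding⇔ : ∀ {n m} (π : Vec (Fin n) m) → Avoiding (values π) ⇔ NoPattern π
  avoiding⇔ π = mk⇔ (to′ π) (from′ π)
    where
    to′ : ∀ {n m} (π : Vec (Fin n) m) → Avoiding (values π) → NoPattern π
    to′ (x ∷ π) (nd ∷ av) zero    (suc j) (suc j⁺) _         eq = to (noDescentBelow⇔ π) nd j j⁺ (suc-injective eq)
    to′ (x ∷ π) (nd ∷ av) (suc i) (suc j) (suc j⁺) (s≤s i<j) eq = to′ π av i j j⁺ i<j (suc-injective eq)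
    from′ : ∀ {n m} (π : Vec (Fin n) m) → NoPattern π → Avoiding (values π)
    from′ []      _ = []
    from′ (x ∷ π) f =
      from (noDescentBelow⇔ π) (λ j j⁺ eq → f zero (suc j) (suc j⁺) (s≤s z≤n) (cong suc eq)) ∷
      from′ π (λ i j j⁺ i<j eq → f (suc i) (suc j) (suc j⁺) (s≤s i<j) (cong suc eq))

  both : ∀ {A B : Set} → A → B → A ⇔ B
  both a b = mk⇔ (λ _ → b) (λ _ → a)

  neither : ∀ {A B : Set} → ¬ A → ¬ B → A ⇔ B
  neither ¬a ¬b = mk⇔ (λ a → contradiction a ¬a) (λ b → contradiction b ¬b)

  orderIsomorphic-21 : ∀ {x y} → y < x → OrderIsomorphic (x ∷ y ∷ []) (2 ∷ 1 ∷ [])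
  orderIsomorphic-21 y<x zero           zero           = neither (<-irrefl refl) (<-irrefl refl)
  orderIsomorphic-21 y<x zero           (suc zero) = neither (<⇒≯ y<x) (from-no (2 <? 1))
  orderIsomorphic-21 y<x (suc zero) zero           = both y<x (from-yes (1 <? 2))
  orderIsomorphic-21 y<x (suc zero) (suc zero) = neither (<-irrefl refl) (<-irrefl refl)

  orderIsomorphic-321 : ∀ {x y z} → y < x → z < y → OrderIsomorphic (x ∷ y ∷ z ∷ []) (3 ∷ 2 ∷ 1 ∷ [])
  orderIsomorphic-321 y<x z<y zero zero                     = neither (<-irrefl refl) (<-irrefl refl)
  orderIsomorphic-321 y<x z<y zero (suc zero)           = neither (<⇒≯ y<x) (from-no (3 <? 2))
  orderIsomorphic-321 y<x z<y zero (suc (suc zero)) = neither (<⇒≯ (<-trans z<y y<x)) (from-no (3 <? 1))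
  orderIsomorphic-321 y<x z<y (suc zero) zero                     = both y<x (from-yes (2 <? 3))
  orderIsomorphic-321 y<x z<y (suc zero) (suc zero)           = neither (<-irrefl refl) (<-irrefl refl)
  orderIsomorphic-321 y<x z<y (suc zero) (suc (suc zero)) = neither (<⇒≯ z<y) (from-no (2 <? 1))
  orderIsomorphic-321 y<x z<y (suc (suc zero)) zero                     = both (<-trans z<y y<x) (from-yes (1 <? 3))
  orderIsomorphic-321 y<x z<y (suc (suc zero)) (suc zero)           = both z<y (from-yes (1 <? 2))
  orderIsomorphic-321 y<x z<y (suc (suc zero)) (suc (suc zero)) = neither (<-irrefl refl) (<-irrefl refl)

  avoids3-21⇔avoiding : ∀ {n} {π : Vec (Fin n) n} → Avoids3-21 π ⇔ Avoiding (values π)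
  avoids3-21⇔avoiding {π = π} = mk⇔
    (λ av → from (avoiding⇔ π) λ i j j⁺ i<j eq j<i → ≮⇒≥ λ j⁺<j →
      av (i , j , j⁺ , i<j , eq , orderIsomorphic-321 j<i j⁺<j))
    (λ { av (i , j , j⁺ , i<j , eq , iso) → <⇒≱ (from (iso (suc (suc zero)) (suc zero)) (from-yes (1 <? 2)))
           (to (avoiding⇔ π) av i j j⁺ i<j eq (from (iso (suc zero) zero) (from-yes (2 <? 3)))) })

  ∈-words : ∀ {n k} (π : Vec (Fin n) k) → π ∈ words n k
  ∈-words []      = here refl
  ∈-words (x ∷ π) = ∈-cartesianProductWith⁺ _∷_ (∈-allFin x) (∈-words π)

  words-unique : ∀ n k → Unique (words n k)
  words-unique n zero    = [] ∷ []
  words-unique n (suc k) = Unique.cartesianProductWith⁺ _∷_ (λ { refl → refl , refl }) (Unique.allFin⁺ n) (words-unique n k)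

  -- Mutual inclusion of two duplicate-free lists bounds each length by the other. `values` is
  -- injective, so it carries the filtered permutations to such a list.
  N3-21-avoiders : ∀ {k} (p : Vec ℕ k) {Q : List ℕ → Set} (Q? : Decidable Q) n →
    (∀ (π : Vec (Fin n) n) → BeginsWith p π ⇔ Q (values π)) →
    N3-21 p n ≡ length (filter Q? (avoiders n (downFrom n)))
  N3-21-avoiders p {Q} Q? n begins = trans (sym (List.length-map values counted))
    (≤-antisym (unique-⊆⇒length≤ (Unique.map⁺ (λ {π} {ρ} → values-injective π ρ) (Unique.filter⁺ _ (words-unique n n))) forth)
               (unique-⊆⇒length≤ (Unique.filter⁺ Q? (avoiders-unique n (downFrom-decreasing n))) back))
    where
    counted : List (Vec (Fin n) n)
    counted = filter (λ π → isPermutation? π ×-dec (avoids3-21? π ×-dec beginsWith? p π)) (words n n)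
    forth : map values counted ⊆ filter Q? (avoiders n (downFrom n))
    forth w∈ with ∈-map⁻ values w∈
    ... | π , π∈ , refl with ∈-filter⁻ _ {xs = words n n} π∈
    ... | _ , perm , av , b = ∈-filter⁺ Q?
      (avoiders-complete n (≤-reflexive (List.length-downFrom n)) (downFrom-decreasing n)
        (to isPermutation⇔↭ perm) (to avoids3-21⇔avoiding av))
      (to (begins π) b)
    back : filter Q? (avoiders n (downFrom n)) ⊆ map values counted
    back {w} w∈ with ∈-filter⁻ Q? {xs = avoiders n (downFrom n)} w∈
    ... | w∈A , q with avoiders-sound n (downFrom-decreasing n) w∈A
    ... | w↭ , av = subst (_∈ map values counted) (proj₂ preimage)
      (∈-map⁺ values (∈-filter⁺ _ (∈-words π)
        (from isPermutation⇔↭ (subst (_↭ downFrom n) (sym (proj₂ preimage)) w↭) ,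
         from avoids3-21⇔avoiding (subst Avoiding (sym (proj₂ preimage)) av) ,
         from (begins π) (subst Q (sym (proj₂ preimage)) q))))
      where
      preimage : ∃ λ (π : Vec (Fin n) n) → values π ≡ w
      preimage = subst (λ m → ∃ λ (π : Vec (Fin n) m) → values π ≡ w)
        (trans (↭-length w↭) (List.length-downFrom n))
        (values-surjective (All-resp-↭ (↭-sym w↭) (downFrom-< n)))
      π : Vec (Fin n) n
      π = proj₁ preimage

  -- The recurrences for k = 1 and k = 2, and the vanishing for k ≥ 3.

  module AllCount = Counting {λ _ → ⊤} (λ _ → yes tt) (λ _ → 0) (λ _ → mk⇔ id id) (λ _ → refl)

  N-1 : ∀ n → N3-21 (decreasing 1) n ≡ AllCount.count n n
  N-1 n = trans (N3-21-avoiders (decreasing 1) (λ _ → yes tt) n (λ π → mk⇔ (λ _ → tt) (λ _ → begins π)))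
    (trans (AllCount.avoiders-count n (downFrom-decreasing n)) (cong (AllCount.count n) (List.length-downFrom n)))
    where
    begins : ∀ {n} (π : Vec (Fin n) n) → BeginsWith (decreasing 1) π
    -- The convention for the empty permutation makes the count start with 1.
    begins []      = inj₂ (refl , refl)
    begins (x ∷ π) = inj₁ (s≤s z≤n , λ { zero zero → neither (<-irrefl refl) (<-irrefl refl) })

  N-1-suc : ∀ n → N3-21 (decreasing 1) (suc n) ≡ binomialTransform (N3-21 (decreasing 1)) n
  N-1-suc n = trans (N-1 (suc n)) (trans (AllCount.avoiders-count-suc n)
    (trans (+-identityʳ _) (binomialTransform-cong n (λ i _ → sym (N-1 i)))))

  data StartsWithDescent : List ℕ → Set where
    descent : ∀ {x y w} → y < x → StartsWithDescent (x ∷ y ∷ w)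

  startsWithDescent? : Decidable StartsWithDescent
  startsWithDescent? []          = no λ ()
  startsWithDescent? (x ∷ [])    = no λ ()
  startsWithDescent? (x ∷ y ∷ w) = map′ descent (λ { (descent y<x) → y<x }) (y <? x)

  -- If a single letter precedes v, then v is the second letter and the word starts with an ascent;
  -- otherwise the first two letters stay the same.
  startsWithDescent-++ : ∀ {s σ v T} → All (_< v) (s ∷ σ) →
    StartsWithDescent (s ∷ σ ++ v ∷ T) ⇔ StartsWithDescent (s ∷ σ)
  startsWithDescent-++ {σ = []}    (s<v ∷ _) = mk⇔ (λ { (descent v<s) → contradiction v<s (<⇒≯ s<v) }) (λ ())
  startsWithDescent-++ {σ = _ ∷ _} _         = mk⇔ (λ { (descent p) → descent p }) (λ { (descent p) → descent p })

  startsWithDescent-max : ∀ {v T} → All (_< v) T →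
    length (filter startsWithDescent? [ v ∷ T ]) ≡ positivity (length T)
  startsWithDescent-max {T = []}    _         = refl
  startsWithDescent-max {v} {t ∷ T} (t<v ∷ _) =
    cong length (List.filter-accept startsWithDescent? {v ∷ t ∷ T} {[]} (descent t<v))

  module DescentCount =
    Counting startsWithDescent? positivity startsWithDescent-++ startsWithDescent-max

  N-21 : ∀ n → N3-21 (decreasing 2) n ≡ DescentCount.count n n
  N-21 n = trans (N3-21-avoiders (decreasing 2) startsWithDescent? n (λ π → mk⇔ (to′ π) (from′ π)))
    (trans (DescentCount.avoiders-count n (downFrom-decreasing n)) (cong (DescentCount.count n) (List.length-downFrom n)))
    where
    to′ : ∀ {n} (π : Vec (Fin n) n) → BeginsWith (decreasing 2) π → StartsWithDescent (values π)
    to′ (x ∷ y ∷ π) (inj₁ (s≤s (s≤s _) , iso)) = descent (from (iso (suc zero) zero) (from-yes (1 <? 2)))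
    from′ : ∀ {n} (π : Vec (Fin n) n) → StartsWithDescent (values π) → BeginsWith (decreasing 2) π
    from′ (x ∷ y ∷ π) (descent y<x) = inj₁ (s≤s (s≤s z≤n) , orderIsomorphic-21 y<x)

  N-21-suc : ∀ n → N3-21 (decreasing 2) (suc n) ≡ binomialTransform (N3-21 (decreasing 2)) n + positivity n
  N-21-suc n = trans (N-21 (suc n)) (trans (DescentCount.avoiders-count-suc n)
    (cong (_+ positivity n) (binomialTransform-cong n (λ i _ → sym (N-21 i)))))

  -- The first letter plays the 3, and the second and third are the adjacent 2 and 1.
  N-321…≡0 : ∀ k n → N3-21 (decreasing (3 + k)) n ≡ 0
  N-321…≡0 k n = cong length (List.filter-none
    (λ π → isPermutation? π ×-dec (avoids3-21? π ×-dec beginsWith? (decreasing (3 + k)) π))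
    (All.tabulate {xs = words n n} λ {π} _ (_ , av , b) → begins π b (to avoids3-21⇔avoiding av)))
    where
    begins : ∀ {n} (π : Vec (Fin n) n) → BeginsWith (decreasing (3 + k)) π → ¬ Avoiding (values π)
    begins (x ∷ y ∷ z ∷ π) (inj₁ (s≤s (s≤s (s≤s _)) , iso)) ((r ∷ _) ∷ _) =
      <⇒≱ (from (iso (suc (suc zero)) (suc zero)) (n<1+n (suc k))) (r (from (iso (suc zero) zero) (n<1+n (2 + k))))

module GeneratingFunctions where

  open import Algebra.Structures using (IsCommutativeRing)
  open import Data.Integer.Base as ℤ using () renaming (+_ to pos)
  import Data.Integer.Properties as ℤ
  open import Data.Nat.Properties using (_!≢0)
  open import Data.Rational.Base
    using (ℚ; 0ℚ; 1ℚ; ½; _<_; _≤_; _+_; _*_; _-_; -_; ∣_∣; _/_; toℚᵘ; nonNegative)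
  import Data.Rational.Properties as ℚ
  open import Algebra.Definitions.RawSemiring ℚ.+-*-rawSemiring using (_^_)
  open import Data.Rational.Solver using (module +-*-Solver)
  import Data.Rational.Unnormalised.Base as ℚᵘ
  import Data.Rational.Unnormalised.Properties as ℚᵘ

  -- Rational sums and reciprocals of factorials.

  ∑≤ℚ-abs : ∀ n f → ∣ ∑≤ℚ n f ∣ ≤ ∑≤ℚ n (∣_∣ ∘ f)
  ∑≤ℚ-abs zero    f = ℚ.≤-refl
  ∑≤ℚ-abs (suc n) f =
    ℚ.≤-trans (ℚ.∣p+q∣≤∣p∣+∣q∣ (∑≤ℚ n f) (f (suc n))) (ℚ.+-monoˡ-≤ ∣ f (suc n) ∣ (∑≤ℚ-abs n f))

  ∑≤ℚ-mono : ∀ n {f g} → (∀ i → i ℕ.≤ n → f i ≤ g i) → ∑≤ℚ n f ≤ ∑≤ℚ n g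
  ∑≤ℚ-mono zero    f≤g = f≤g 0 z≤n
  ∑≤ℚ-mono (suc n) f≤g =
    ℚ.+-mono-≤ (∑≤ℚ-mono n (λ i i≤n → f≤g i (ℕ.m≤n⇒m≤1+n i≤n))) (f≤g (suc n) ℕ.≤-refl)

  fromℕ-suc : ∀ n → fromℕ (suc n) ≡ 1ℚ + fromℕ n
  fromℕ-suc n = ℚ.toℚᵘ-injective (begin
    toℚᵘ (fromℕ (suc n))            ≈⟨ toℚᵘ-fromℕ (suc n) ⟩
    ℚᵘ.mkℚᵘ (pos (suc n)) 0         ≈⟨ ℚᵘ.*≡* (cong (λ k → (pos 1 ℤ.+ k) ℤ.* pos 1) (sym (ℤ.*-identityʳ (pos n)))) ⟩
    ℚᵘ.1ℚᵘ ℚᵘ.+ ℚᵘ.mkℚᵘ (pos n) 0     ≈⟨ ℚᵘ.+-congʳ ℚᵘ.1ℚᵘ (toℚᵘ-fromℕ n) ⟨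
    toℚᵘ 1ℚ ℚᵘ.+ toℚᵘ (fromℕ n)     ≈⟨ ℚ.toℚᵘ-homo-+ 1ℚ (fromℕ n) ⟨
    toℚᵘ (1ℚ + fromℕ n)             ∎)
    where open ℚᵘ.≃-Reasoning

  fromℕ-inverse : ∀ n → fromℕ (suc n) * (pos 1 / suc n) ≡ 1ℚ
  fromℕ-inverse n = ℚ.toℚᵘ-injective (begin
    toℚᵘ (fromℕ (suc n) * (pos 1 / suc n))
      ≈⟨ ℚ.toℚᵘ-homo-* (fromℕ (suc n)) (pos 1 / suc n) ⟩
    toℚᵘ (fromℕ (suc n)) ℚᵘ.* toℚᵘ (pos 1 / suc n)
      ≈⟨ ℚᵘ.*-cong (toℚᵘ-fromℕ (suc n)) (ℚ.toℚᵘ-fromℚᵘ (ℚᵘ.mkℚᵘ (pos 1) n)) ⟩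
    ℚᵘ.mkℚᵘ (pos (suc n)) 0 ℚᵘ.* ℚᵘ.mkℚᵘ (pos 1) n
      ≈⟨ ℚᵘ.*≡* (trans (ℤ.*-identityʳ _) (trans (ℤ.*-identityʳ (pos (suc n)))
           (sym (trans (ℤ.*-identityˡ _) (cong (λ k → pos (suc k)) (ℕ.+-identityʳ n)))))) ⟩
    toℚᵘ 1ℚ ∎)
    where open ℚᵘ.≃-Reasoning

  /!≡1/!* : ∀ m n → _/_ (pos m) (n !) {{n !≢0}} ≡ 1/! n * fromℕ m
  /!≡1/!* m n = go m (n !) {{n !≢0}}
    where
    go : ∀ m d .{{_ : ℕ.NonZero d}} → pos m / d ≡ (pos 1 / d) * fromℕ m
    go m (suc d) = ℚ.toℚᵘ-injective (begin
      toℚᵘ (pos m / suc d)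
        ≈⟨ ℚ.toℚᵘ-fromℚᵘ (ℚᵘ.mkℚᵘ (pos m) d) ⟩
      ℚᵘ.mkℚᵘ (pos m) d
        ≈⟨ ℚᵘ.*≡* (trans (cong (λ k → pos m ℤ.* pos k) (ℕ.*-identityʳ (suc d)))
                         (cong (ℤ._* pos (suc d)) (sym (ℤ.*-identityˡ (pos m))))) ⟩
      ℚᵘ.mkℚᵘ (pos 1) d ℚᵘ.* ℚᵘ.mkℚᵘ (pos m) 0
        ≈⟨ ℚᵘ.*-cong (ℚ.toℚᵘ-fromℚᵘ (ℚᵘ.mkℚᵘ (pos 1) d)) (toℚᵘ-fromℕ m) ⟨
      toℚᵘ (pos 1 / suc d) ℚᵘ.* toℚᵘ (fromℕ m)
        ≈⟨ ℚ.toℚᵘ-homo-* (pos 1 / suc d) (fromℕ m) ⟨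
      toℚᵘ ((pos 1 / suc d) * fromℕ m) ∎)
      where open ℚᵘ.≃-Reasoning

  -- The product e · e⁻¹ by formal series over the rationals.

  module ℚSeries = FormalSeries ℚ.+-*-commutativeRing ∑≤ℚ (λ _ → refl) (λ _ _ → refl) fromℕ refl fromℕ-suc

  module ℚSeriesInv = ℚSeries.WithInverses (λ n → pos 1 / suc n) fromℕ-inverse 1/! refl 1/!-suc

  open ℚSeries using (_•_; _⊛_)

  D-expTerm : ∀ q n → ℚSeries.D (expTerm q) n ≡ q * expTerm q n
  D-expTerm q n = begin
    fromℕ (suc n) * expTerm q (suc n)      ≡⟨ ℚ.*-comm (fromℕ (suc n)) (expTerm q (suc n)) ⟩
    expTerm q (suc n) * fromℕ (suc n)      ≡⟨ expTerm-suc q n ⟩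
    expTerm q n * q                        ≡⟨ ℚ.*-comm (expTerm q n) q ⟩
    q * expTerm q n                        ∎
    where open ≡-Reasoning

  -- The binomial theorem without binomial coefficients: as series, `expTerm p` is e^{px}, and both
  -- sides satisfy y′ = (p + q) y with constant term 1.
  expTerm-⊛ : ∀ p q n → (expTerm p ⊛ expTerm q) n ≡ expTerm (p + q) n
  expTerm-⊛ p q zero    = refl
  expTerm-⊛ p q (suc n) = ℚSeriesInv.ν-cancel n (begin
    ℚSeries.D (expTerm p ⊛ expTerm q) n
      ≡⟨ ℚSeries.D-⊛ (expTerm p) (expTerm q) n ⟩
    (ℚSeries.D (expTerm p) ⊛ expTerm q) n + (expTerm p ⊛ ℚSeries.D (expTerm q)) n
      ≡⟨ cong₂ _+_ (ℚSeries.⊛-congʳ (expTerm q) (D-expTerm p) n) (ℚSeries.⊛-congˡ (expTerm p) (D-expTerm q) n) ⟩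
    ((p • expTerm p) ⊛ expTerm q) n + (expTerm p ⊛ (q • expTerm q)) n
      ≡⟨ cong₂ _+_ (ℚSeries.•-⊛ p (expTerm p) (expTerm q) n) (ℚSeries.⊛-• q (expTerm p) (expTerm q) n) ⟩
    p * (expTerm p ⊛ expTerm q) n + q * (expTerm p ⊛ expTerm q) n
      ≡⟨ ℚ.*-distribʳ-+ ((expTerm p ⊛ expTerm q) n) p q ⟨
    (p + q) * (expTerm p ⊛ expTerm q) n
      ≡⟨ cong ((p + q) *_) (expTerm-⊛ p q n) ⟩
    (p + q) * expTerm (p + q) n
      ≡⟨ D-expTerm (p + q) n ⟨
    ℚSeries.D (expTerm (p + q)) n ∎)
    where open ≡-Reasoning

  expTerm-0 : ∀ n → expTerm 0ℚ n ≡ ℚSeries.1ˢ n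
  expTerm-0 zero    = refl
  expTerm-0 (suc n) = trans (cong (1/! (suc n) *_) (ℚ.*-zeroˡ (0ℚ ^ n))) (ℚ.*-zeroʳ (1/! (suc n)))

  expSum-0 : ∀ n → expSum n 0ℚ ≡ 1ℚ
  expSum-0 zero    = refl
  expSum-0 (suc n) = trans (cong₂ _+_ (expSum-0 n) (expTerm-0 (suc n))) (ℚ.+-identityʳ 1ℚ)

  ones : ℕ → ℚ
  ones _ = 1ℚ

  -- Multiplying by 1/(1 - x) takes partial sums.
  ⊛-ones : ∀ f n → (f ⊛ ones) n ≡ ∑≤ℚ n f
  ⊛-ones f n = ℚSeries.∑-cong n (λ i _ → ℚ.*-identityʳ (f i))

  expSum-convolution : ∀ q n → (expTerm q ⊛ λ i → expSum i (- q)) n ≡ 1ℚ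
  expSum-convolution q n = begin
    (expTerm q ⊛ λ i → expSum i (- q)) n
      ≡⟨ ℚSeries.⊛-congˡ (expTerm q) (⊛-ones (expTerm (- q))) n ⟨
    (expTerm q ⊛ (expTerm (- q) ⊛ ones)) n
      ≡⟨ ℚSeries.⊛-assoc (expTerm q) (expTerm (- q)) ones n ⟨
    ((expTerm q ⊛ expTerm (- q)) ⊛ ones) n
      ≡⟨ ℚSeries.⊛-congʳ ones inverse n ⟩
    (ℚSeries.1ˢ ⊛ ones) n
      ≡⟨ ℚSeries.⊛-identityˡ ones n ⟩
    1ℚ ∎
    where
    open ≡-Reasoning
    inverse : ∀ n → (expTerm q ⊛ expTerm (- q)) n ≡ ℚSeries.1ˢ n
    inverse n = trans (expTerm-⊛ q (- q) n) (trans (cong (λ s → expTerm s n) (ℚ.+-inverseʳ q)) (expTerm-0 n))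

  expTerm-decreasing : ∀ {q} m n → 0ℚ ≤ q → m ℕ.≤ suc n → q ≤ 1ℚ →
                       fromℕ m * expTerm q (suc n) ≤ expTerm q n
  expTerm-decreasing {q} m n q≥0 m≤1+n q≤1 = begin
    fromℕ m * expTerm q (suc n)         ≤⟨ ℚ.*-monoʳ-≤-nonNeg (expTerm q (suc n)) {{nonNegative (expTerm≥0 (suc n) q≥0)}} (fromℕ-mono m≤1+n) ⟩
    fromℕ (suc n) * expTerm q (suc n)   ≡⟨ ℚ.*-comm (fromℕ (suc n)) (expTerm q (suc n)) ⟩
    expTerm q (suc n) * fromℕ (suc n)   ≡⟨ expTerm-suc q n ⟩
    expTerm q n * q                     ≤⟨ ℚ.*-monoˡ-≤-nonNeg (expTerm q n) {{nonNegative (expTerm≥0 n q≥0)}} q≤1 ⟩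
    expTerm q n * 1ℚ                    ≡⟨ ℚ.*-identityʳ (expTerm q n) ⟩
    expTerm q n                         ∎
    where open ℚ.≤-Reasoning

  2ℚ : ℚ
  2ℚ = fromℕ 2

  0≤1 : 0ℚ ≤ 1ℚ
  0≤1 = ℚ.<⇒≤ 0<1

  -- From 1/1! on, the terms 1/n! at least halve, so twice the first omitted term dominates the
  -- remaining tail.
  expSum₁-antitone : ∀ {m n} → m ℕ.≤ n →
    expSum n 1ℚ + 2ℚ * expTerm 1ℚ (suc n) ≤ expSum m 1ℚ + 2ℚ * expTerm 1ℚ (suc m)
  expSum₁-antitone {m} {n} m≤n = go (ℕ.≤⇒≤′ m≤n)
    where
    open ℚ.≤-Reasoning
    go : ∀ {n} → m ℕ.≤′ n → expSum n 1ℚ + 2ℚ * expTerm 1ℚ (suc n) ≤ expSum m 1ℚ + 2ℚ * expTerm 1ℚ (suc m)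
    go ℕ.≤′-refl = ℚ.≤-refl
    go {suc n} (ℕ.≤′-step m≤′n) = begin
      expSum n 1ℚ + t + 2ℚ * expTerm 1ℚ (suc (suc n))
        ≤⟨ ℚ.+-monoʳ-≤ (expSum n 1ℚ + t) (expTerm-decreasing {1ℚ} 2 (suc n) 0≤1 (s≤s (s≤s z≤n)) ℚ.≤-refl) ⟩
      expSum n 1ℚ + t + t
        ≡⟨ eq (expSum n 1ℚ) t ⟩
      expSum n 1ℚ + 2ℚ * t
        ≤⟨ go m≤′n ⟩
      expSum m 1ℚ + 2ℚ * expTerm 1ℚ (suc m) ∎
      where
      t : ℚ
      t = expTerm 1ℚ (suc n)
      eq : ∀ a b → a + b + b ≡ a + 2ℚ * b
      eq = +-*-Solver.solve 2 (λ a b → a :+ b :+ b := a :+ con 2ℚ :* b) refl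
        where open +-*-Solver

  -- The sharper bound would have term m + 1. Term m is used because at m = n - i the bounds then
  -- add up to a convolution of exponential terms.
  expSum-tail≤2term : ∀ {q m n} → ∣ q ∣ ≤ 1ℚ → m ℕ.≤ n → ∣ expSum n q - expSum m q ∣ ≤ 2ℚ * expTerm 1ℚ m
  expSum-tail≤2term {q} {m} {n} ∣q∣≤1 m≤n = begin
    ∣ expSum n q - expSum m q ∣
      ≤⟨ expSum-tail {q} {1ℚ} {m} {n} ∣q∣≤1 m≤n ⟩
    expSum n 1ℚ - s
      ≤⟨ ℚ.+-monoˡ-≤ (- s) (p≤p+q (expSum n 1ℚ) {2ℚ * expTerm 1ℚ (suc n)} (*-nonneg {2ℚ} (fromℕ≥0 2) (expTerm≥0 (suc n) 0≤1))) ⟩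
    expSum n 1ℚ + 2ℚ * expTerm 1ℚ (suc n) - s
      ≤⟨ ℚ.+-monoˡ-≤ (- s) (expSum₁-antitone m≤n) ⟩
    s + 2ℚ * expTerm 1ℚ (suc m) - s
      ≡⟨ eq s (2ℚ * expTerm 1ℚ (suc m)) ⟩
    2ℚ * expTerm 1ℚ (suc m)
      ≤⟨ ℚ.*-monoˡ-≤-nonNeg 2ℚ (subst (_≤ expTerm 1ℚ m) (ℚ.*-identityˡ (expTerm 1ℚ (suc m)))
           (expTerm-decreasing {1ℚ} 1 m 0≤1 (s≤s z≤n) ℚ.≤-refl)) ⟩
    2ℚ * expTerm 1ℚ m ∎
    where
    open ℚ.≤-Reasoning
    s : ℚ
    s = expSum m 1ℚ
    eq : ∀ a b → a + b - a ≡ b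
    eq = +-*-Solver.solve 2 (λ a b → a :+ b :- a := b) refl
      where open +-*-Solver

  -- The convolution of 1/i! with the partial sums B i of e⁻¹ is 1, so the difference is
  -- ∑ᵢ (B n - B (n - i)) / i!, at most 2 ∑ᵢ 1 / (i! (n - i)!).
  expSum-product : ∀ n → ∣ expSum n 1ℚ * expSum n (- 1ℚ) - 1ℚ ∣ ≤ 2ℚ * expTerm 2ℚ n
  expSum-product n = begin
    ∣ expSum n 1ℚ * expSum n (- 1ℚ) - 1ℚ ∣
      ≡⟨ cong ∣_∣ (trans (cong₂ _-_ (ℚ.*-comm (expSum n 1ℚ) (B n)) (sym (expSum-convolution 1ℚ n))) defect) ⟩
    ∣ ∑≤ℚ n (λ i → expTerm 1ℚ i * (B n - B (n ∸ i))) ∣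
      ≤⟨ ∑≤ℚ-abs n (λ i → expTerm 1ℚ i * (B n - B (n ∸ i))) ⟩
    ∑≤ℚ n (λ i → ∣ expTerm 1ℚ i * (B n - B (n ∸ i)) ∣)
      ≤⟨ ∑≤ℚ-mono n termwise ⟩
    (expTerm 1ℚ ⊛ (2ℚ • expTerm 1ℚ)) n
      ≡⟨ ℚSeries.⊛-• 2ℚ (expTerm 1ℚ) (expTerm 1ℚ) n ⟩
    2ℚ * (expTerm 1ℚ ⊛ expTerm 1ℚ) n
      ≡⟨ cong (2ℚ *_) (expTerm-⊛ 1ℚ 1ℚ n) ⟩
    2ℚ * expTerm 2ℚ n ∎
    where
    open ℚ.≤-Reasoning
    B : ℕ → ℚ
    B i = expSum i (- 1ℚ)
    eq : ∀ a b c → c * a + - 1ℚ * (a * b) ≡ a * (c - b)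
    eq = +-*-Solver.solve 3 (λ a b c → c :* a :+ con (- 1ℚ) :* (a :* b) := a :* (c :- b)) refl
      where open +-*-Solver
    neg : ∀ a → - a ≡ - 1ℚ * a
    neg = +-*-Solver.solve 1 (λ a → :- a := con (- 1ℚ) :* a) refl
      where open +-*-Solver
    defect : B n * expSum n 1ℚ - (expTerm 1ℚ ⊛ B) n ≡ ∑≤ℚ n (λ i → expTerm 1ℚ i * (B n - B (n ∸ i)))
    defect = trans
      (cong₂ _+_ (sym (ℚSeries.∑-distribˡ-* n (B n) (expTerm 1ℚ)))
        (trans (neg ((expTerm 1ℚ ⊛ B) n)) (sym (ℚSeries.∑-distribˡ-* n (- 1ℚ) (λ i → expTerm 1ℚ i * B (n ∸ i))))))
      (trans (sym (ℚSeries.∑-distrib-+ n _ _))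
        (ℚSeries.∑-cong n (λ i _ → eq (expTerm 1ℚ i) (B (n ∸ i)) (B n))))
    termwise : ∀ i → i ℕ.≤ n →
      ∣ expTerm 1ℚ i * (B n - B (n ∸ i)) ∣ ≤ expTerm 1ℚ i * (2ℚ * expTerm 1ℚ (n ∸ i))
    termwise i i≤n = begin
      ∣ expTerm 1ℚ i * (B n - B (n ∸ i)) ∣
        ≡⟨ ℚ.∣p*q∣≡∣p∣*∣q∣ (expTerm 1ℚ i) (B n - B (n ∸ i)) ⟩
      ∣ expTerm 1ℚ i ∣ * ∣ B n - B (n ∸ i) ∣
        ≡⟨ cong (_* ∣ B n - B (n ∸ i) ∣) (ℚ.0≤p⇒∣p∣≡p (expTerm≥0 i 0≤1)) ⟩
      expTerm 1ℚ i * ∣ B n - B (n ∸ i) ∣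
        ≤⟨ ℚ.*-monoˡ-≤-nonNeg (expTerm 1ℚ i) {{nonNegative (expTerm≥0 i 0≤1)}}
             (expSum-tail≤2term { - 1ℚ} ℚ.≤-refl (ℕ.m∸n≤m n i)) ⟩
      expTerm 1ℚ i * (2ℚ * expTerm 1ℚ (n ∸ i)) ∎

  -- The commutative ring of Cauchy reals.

  seq-≡⇒≈ : ∀ {x y} → (∀ n → seq x n ≡ seq y n) → x ≈ y
  seq-≡⇒≈ {x} {y} eq ε ε>0 = 0 , λ n _ → subst (λ q → ∣ q ∣ < ε)
    (sym (trans (cong (_- seq y n) (eq n)) (ℚ.+-inverseʳ (seq y n)))) ε>0

  ≈-refl : ∀ {x} → x ≈ x
  ≈-refl {x} = seq-≡⇒≈ {x} {x} λ _ → refl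

  ≈-sym : ∀ {x y} → x ≈ y → y ≈ x
  ≈-sym {x} {y} x≈y ε ε>0 with x≈y ε ε>0
  ... | N , h = N , λ n N≤n → subst (_< ε) (dist-swap (seq x n) (seq y n)) (h n N≤n)

  ≈-trans : ∀ {x y z} → x ≈ y → y ≈ z → x ≈ z
  ≈-trans {x} {y} {z} x≈y y≈z ε ε>0 with x≈y (½ * ε) (half-pos ε>0) | y≈z (½ * ε) (half-pos ε>0)
  ... | M , h | N , k = M ℕ.⊔ N , λ n p → dist-shrink {seq x n} {seq y n} {seq z n}
    (h n (ℕ.m⊔n≤o⇒m≤o M N p)) (k n (ℕ.m⊔n≤o⇒n≤o M N p))

  +ℝ-cong : ∀ {x x′ y y′} → x ≈ x′ → y ≈ y′ → x +ℝ y ≈ x′ +ℝ y′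
  +ℝ-cong {x} {x′} {y} {y′} x≈x′ y≈y′ ε ε>0
    with x≈x′ (½ * ε) (half-pos ε>0) | y≈y′ (½ * ε) (half-pos ε>0)
  ... | M , h | N , k = M ℕ.⊔ N , λ n p → subst (_ <_) (half+half ε) (ℚ.≤-<-trans
      (subst (_≤ ∣ seq x n - seq x′ n ∣ + ∣ seq y n - seq y′ n ∣)
        (cong ∣_∣ (eq (seq x n) (seq x′ n) (seq y n) (seq y′ n)))
        (ℚ.∣p+q∣≤∣p∣+∣q∣ (seq x n - seq x′ n) (seq y n - seq y′ n)))
      (ℚ.+-mono-< (h n (ℕ.m⊔n≤o⇒m≤o M N p)) (k n (ℕ.m⊔n≤o⇒n≤o M N p))))
    where
    eq : ∀ a b c d → (a - b) + (c - d) ≡ (a + c) - (b + d)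
    eq = +-*-Solver.solve 4 (λ a b c d → (a :- b) :+ (c :- d) := (a :+ c) :- (b :+ d)) refl
      where open +-*-Solver

  -ℝ-cong : ∀ {x y} → x ≈ y → -ℝ x ≈ -ℝ y
  -ℝ-cong {x} {y} x≈y ε ε>0 with x≈y ε ε>0
  ... | N , h = N , λ n N≤n → subst (_< ε)
    (trans (dist-swap (seq x n) (seq y n)) (cong ∣_∣ (eq (seq x n) (seq y n)))) (h n N≤n)
    where
    eq : ∀ a b → b - a ≡ - a - - b
    eq = +-*-Solver.solve 2 (λ a b → b :- a := :- a :- :- b) refl
      where open +-*-Solver

  *ℝ-congʳ : ∀ {x x′} y → x ≈ x′ → x *ℝ y ≈ x′ *ℝ y
  *ℝ-congʳ {x} {x′} y x≈x′ ε ε>0 with bounded (seq y) (cauchy y)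
  ... | C , 1≤C , y≤C with scale C ε 1≤C ε>0
  ... | δ , δ>0 , δC<ε with x≈x′ δ δ>0
  ... | N , h = N , λ n N≤n → begin-strict
    ∣ seq x n * seq y n - seq x′ n * seq y n ∣
      ≡⟨ cong ∣_∣ (eq (seq x n) (seq x′ n) (seq y n)) ⟩
    ∣ (seq x n - seq x′ n) * seq y n ∣
      ≡⟨ ℚ.∣p*q∣≡∣p∣*∣q∣ (seq x n - seq x′ n) (seq y n) ⟩
    ∣ seq x n - seq x′ n ∣ * ∣ seq y n ∣
      ≤⟨ ℚ.*-monoˡ-≤-nonNeg ∣ seq x n - seq x′ n ∣ {{ℚ.∣-∣-nonNeg (seq x n - seq x′ n)}} (y≤C n) ⟩
    ∣ seq x n - seq x′ n ∣ * C
      <⟨ δC<ε (h n N≤n) ⟩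
    ε ∎
    where
    open ℚ.≤-Reasoning
    eq : ∀ a b c → a * c - b * c ≡ (a - b) * c
    eq = +-*-Solver.solve 3 (λ a b c → a :* c :- b :* c := (a :- b) :* c) refl
      where open +-*-Solver

  *ℝ-comm : ∀ x y → x *ℝ y ≈ y *ℝ x
  *ℝ-comm x y = seq-≡⇒≈ {x *ℝ y} {y *ℝ x} λ n → ℚ.*-comm (seq x n) (seq y n)

  *ℝ-cong : ∀ {x x′ y y′} → x ≈ x′ → y ≈ y′ → x *ℝ y ≈ x′ *ℝ y′
  *ℝ-cong {x} {x′} {y} {y′} x≈x′ y≈y′ =
    ≈-trans {x *ℝ y} {x′ *ℝ y} {x′ *ℝ y′} (*ℝ-congʳ {x} {x′} y x≈x′)
      (≈-trans {x′ *ℝ y} {y *ℝ x′} {x′ *ℝ y′} (*ℝ-comm x′ y)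
        (≈-trans {y *ℝ x′} {y′ *ℝ x′} {x′ *ℝ y′} (*ℝ-congʳ {y} {y′} x′ y≈y′) (*ℝ-comm y′ x′)))

  ℝ-isCommutativeRing : IsCommutativeRing _≈_ _+ℝ_ _*ℝ_ -ℝ_ 0ℝ 1ℝ
  ℝ-isCommutativeRing = record
      { isRing = record
        { +-isAbelianGroup = record
          { isGroup = record
            { isMonoid = record
              { isSemigroup = record
                { isMagma = record
                  { isEquivalence = record
                    { refl  = λ {x} → ≈-refl {x}
                    ; sym   = λ {x} {y} → ≈-sym {x} {y}
                    ; trans = λ {x} {y} {z} → ≈-trans {x} {y} {z}
                    }
                  ; ∙-cong = λ {x} {x′} {y} {y′} → +ℝ-cong {x} {x′} {y} {y′}
                  }
                ; assoc = λ x y z → seq-≡⇒≈ {(x +ℝ y) +ℝ z} {x +ℝ (y +ℝ z)} λ n →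
                    ℚ.+-assoc (seq x n) (seq y n) (seq z n)
                }
              ; identity =
                  (λ x → seq-≡⇒≈ {0ℝ +ℝ x} {x} λ n → ℚ.+-identityˡ (seq x n)) ,
                  (λ x → seq-≡⇒≈ {x +ℝ 0ℝ} {x} λ n → ℚ.+-identityʳ (seq x n))
              }
            ; inverse =
                (λ x → seq-≡⇒≈ {(-ℝ x) +ℝ x} {0ℝ} λ n → ℚ.+-inverseˡ (seq x n)) ,
                (λ x → seq-≡⇒≈ {x +ℝ (-ℝ x)} {0ℝ} λ n → ℚ.+-inverseʳ (seq x n))
            ; ⁻¹-cong = λ {x} {y} → -ℝ-cong {x} {y}
            }
          ; comm = λ x y → seq-≡⇒≈ {x +ℝ y} {y +ℝ x} λ n → ℚ.+-comm (seq x n) (seq y n)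
          }
        ; *-cong = λ {x} {x′} {y} {y′} → *ℝ-cong {x} {x′} {y} {y′}
        ; *-assoc = λ x y z → seq-≡⇒≈ {(x *ℝ y) *ℝ z} {x *ℝ (y *ℝ z)} λ n →
            ℚ.*-assoc (seq x n) (seq y n) (seq z n)
        ; *-identity =
            (λ x → seq-≡⇒≈ {1ℝ *ℝ x} {x} λ n → ℚ.*-identityˡ (seq x n)) ,
            (λ x → seq-≡⇒≈ {x *ℝ 1ℝ} {x} λ n → ℚ.*-identityʳ (seq x n))
        ; distrib =
            (λ x y z → seq-≡⇒≈ {x *ℝ (y +ℝ z)} {x *ℝ y +ℝ x *ℝ z} λ n →
              ℚ.*-distribˡ-+ (seq x n) (seq y n) (seq z n)) ,
            (λ x y z → seq-≡⇒≈ {(y +ℝ z) *ℝ x} {y *ℝ x +ℝ z *ℝ x} λ n →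
              ℚ.*-distribʳ-+ (seq x n) (seq y n) (seq z n))
        }
      ; *-comm = *ℝ-comm
      }

  ℝ-commutativeRing : CommutativeRing _ _
  ℝ-commutativeRing = record { isCommutativeRing = ℝ-isCommutativeRing }

  -- The generating functions as series over the reals.

  module ℝSeries = FormalSeries ℝ-commutativeRing
    ∑≤ℝ (λ f → ≈-refl {f 0}) (λ n f → ≈-refl {∑≤ℝ n f +ℝ f (suc n)})
    (λ n → fromℚ (fromℕ n)) (≈-refl {0ℝ})
    (λ n → seq-≡⇒≈ {fromℚ (fromℕ (suc n))} {1ℝ +ℝ fromℚ (fromℕ n)} λ _ → fromℕ-suc n)

  module ℝSeriesInv = ℝSeries.WithInverses
    (λ n → fromℚ (pos 1 / suc n))
    (λ n → seq-≡⇒≈ {fromℚ (fromℕ (suc n)) *ℝ fromℚ (pos 1 / suc n)} {1ℝ} λ _ → fromℕ-inverse n)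
    (λ n → fromℚ (1/! n)) (≈-refl {1ℝ})
    (λ n → seq-≡⇒≈ {fromℚ (1/! (suc n)) *ℝ fromℚ (fromℕ (suc n))} {fromℚ (1/! n)} λ _ → 1/!-suc n)

  open ℝSeriesInv using (IsExp)

  𝟙≋1ˢ : ∀ n → 𝟙 n ≈ ℝSeries.1ˢ n
  𝟙≋1ˢ zero    = ≈-refl {1ℝ}
  𝟙≋1ˢ (suc n) = ≈-refl {0ℝ}

  isExp : ∀ f → IsExp f (exp f)
  isExp f = record
    { g      = dropConstant f
    ; g-zero = ≈-refl {0ℝ}
    ; g-suc  = λ n → ≈-refl {f (suc n)}
    ; P      = dropConstant f ^^_
    ; P-zero = 𝟙≋1ˢ
    ; P-suc  = λ m n → ≈-refl {(dropConstant f ^^ suc m) n}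
    ; const  = expℝ (f 0)
    ; S-def  = λ n → ≈-refl {exp f n}
    }

  -- Equality of the approximations, stronger than equality of the reals, passes through `expℝ`
  -- without a continuity argument. The constant terms 0, 1 and -1 that occur all have constant
  -- approximations.
  exp-constant : ∀ f {q} → (∀ n → seq (f 0) n ≡ q) → ∀ n → seq (exp f 0) n ≡ expSum n q
  exp-constant f {q} f₀ n = trans (ℚ.*-identityʳ (expSum n (seq (f 0) n))) (cong (expSum n) (f₀ n))

  expX-constant : ∀ n → seq (exp X 0) n ≡ 1ℚ
  expX-constant n = trans (exp-constant X {0ℚ} (λ _ → refl) n) (expSum-0 n)

  expX-1-suc : ∀ n → (exp X ⊖ 𝟙) (suc n) ≈ exp X (suc n)
  expX-1-suc n = seq-≡⇒≈ {(exp X ⊖ 𝟙) (suc n)} {exp X (suc n)} λ j → ℚ.+-identityʳ (seq (exp X (suc n)) j)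

  expX-1-zero : ∀ n → seq ((exp X ⊖ 𝟙) 0) n ≡ 0ℚ
  expX-1-zero n = cong (_- 1ℚ) (expX-constant n)

  egf⇒E3-21 : ∀ {k} (p : Vec ℕ k) {f} → (∀ n → f n ≈ fromℚ (1/! n) *ℝ fromℚ (fromℕ (N3-21 p n))) → E3-21 p ≋ f
  egf⇒E3-21 p {f} f≈ n = ≈-trans {E3-21 p n} {fromℚ (1/! n) *ℝ fromℚ (fromℕ (N3-21 p n))} {f n}
    (seq-≡⇒≈ {E3-21 p n} {fromℚ (1/! n) *ℝ fromℚ (fromℕ (N3-21 p n))} λ _ → /!≡1/!* (N3-21 p n) n)
    (≈-sym {f n} {fromℚ (1/! n) *ℝ fromℚ (fromℕ (N3-21 p n))} (f≈ n))

  X₁ : X 1 ≈ 1ℝ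
  X₁ = ≈-refl {1ℝ}

  X₂ : ∀ n → X (suc (suc n)) ≈ 0ℝ
  X₂ n = ≈-refl {0ℝ}

  e₀ : exp X 0 ≈ 1ℝ
  e₀ = seq-≡⇒≈ {exp X 0} {1ℝ} expX-constant

  bell-egf : ∀ {k} (p : Vec ℕ k) → N3-21 p 0 ≡ 1 →
    (∀ n → N3-21 p (suc n) ≡ binomialTransform (N3-21 p) n) → E3-21 p ≋ exp (exp X ⊖ 𝟙)
  bell-egf p N₀ N-suc = egf⇒E3-21 p {f}
    (ℝSeriesInv.exp[eˣ-1] {X} {exp X} X₁ X₂ (isExp X) e₀ {exp X ⊖ 𝟙} expX-1-suc
      {f} {N3-21 p} (isExp (exp X ⊖ 𝟙)) f₀ N-suc)
    where
    f : PowerSeries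
    f = exp (exp X ⊖ 𝟙)
    f₀ : f 0 ≈ fromℚ (fromℕ (N3-21 p 0))
    f₀ = seq-≡⇒≈ {f 0} {fromℚ (fromℕ (N3-21 p 0))} λ k → trans
      (trans (exp-constant (exp X ⊖ 𝟙) expX-1-zero k) (expSum-0 k))
      (sym (cong fromℕ N₀))

  exp₁*exp₋₁ : ∀ {x y : ℝ} → (∀ n → seq x n ≡ expSum n 1ℚ) → (∀ n → seq y n ≡ expSum n (- 1ℚ)) → x *ℝ y ≈ 1ℝ
  exp₁*exp₋₁ {x} {y} x≡ y≡ ε ε>0 = proj₁ small , λ n N≤n →
    ℚ.≤-<-trans {∣ seq x n * seq y n - 1ℚ ∣} {2ℚ * expTerm 2ℚ n} {ε}
      (subst (λ q → ∣ q - 1ℚ ∣ ≤ 2ℚ * expTerm 2ℚ n) (sym (cong₂ _*_ (x≡ n) (y≡ n))) (expSum-product n))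
      (subst (_< ε) (ℚ.*-comm (expTerm 2ℚ n) 2ℚ) (proj₂ (proj₂ scaled) {expTerm 2ℚ n} (proj₂ small n N≤n)))
    where
    scaled : ∃ λ δ → 0ℚ < δ × (∀ {d} → d < δ → d * 2ℚ < ε)
    scaled = scale 2ℚ ε (fromℕ-mono {1} {2} (s≤s z≤n)) ε>0
    small : ∃ λ N → ∀ n → N ℕ.≤ n → expTerm 2ℚ n < proj₁ scaled
    -- 4 = 2 + 2: from this index on the terms 2ⁿ/n! at least halve.
    small = expTerm→0 {2ℚ} {4} (fromℕ≥0 2) ℚ.≤-refl (proj₁ scaled) (proj₁ (proj₂ scaled))

  descent-egf : ∀ {k} (p : Vec ℕ k) → N3-21 p 0 ≡ 0 →
    (∀ n → N3-21 p (suc n) ≡ binomialTransform (N3-21 p) n ℕ.+ positivity n) →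
    E3-21 p ≋ exp (exp X) ⊗ ∫ (exp (⊖ exp X) ⊗ (exp X ⊖ 𝟙))
  descent-egf p N₀ N-suc = egf⇒E3-21 p {exp (exp X) ⊗ ∫ (exp (⊖ exp X) ⊗ (exp X ⊖ 𝟙))}
    (ℝSeriesInv.variation-of-constants {X} {exp X} X₁ X₂ (isExp X) e₀ {exp X ⊖ 𝟙} expX-1-suc
      {⊖ exp X} {exp (exp X)} {exp (⊖ exp X)} {∫ (exp (⊖ exp X) ⊗ (exp X ⊖ 𝟙))} {N3-21 p}
      (seq-≡⇒≈ {(exp X ⊖ 𝟙) 0} {0ℝ} expX-1-zero) (λ n → ≈-refl { -ℝ (exp X n)})
      (isExp (exp X)) (isExp (⊖ exp X))
      -- The exponents eˣ and -eˣ have constant terms 1 and -1, so the constant terms of the two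
      -- exponentials are e and e⁻¹.
      (exp₁*exp₋₁ {exp (exp X) 0} {exp (⊖ exp X) 0} (exp-constant (exp X) {1ℚ} expX-constant)
        (exp-constant (⊖ exp X) { - 1ℚ} (λ n → cong -_ (expX-constant n))))
      (≈-refl {0ℝ}) (λ n → ≈-refl {∫ (exp (⊖ exp X) ⊗ (exp X ⊖ 𝟙)) (suc n)}) N₀ N-suc)

  E≋𝟘 : ∀ {k} (p : Vec ℕ k) → (∀ n → N3-21 p n ≡ 0) → E3-21 p ≋ 𝟘
  E≋𝟘 p N≡0 n = seq-≡⇒≈ {E3-21 p n} {0ℝ} λ _ → trans (/!≡1/!* (N3-21 p n) n)
    (trans (cong (λ m → 1/! n * fromℕ m) (N≡0 n)) (ℚ.*-zeroʳ (1/! n)))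

open Counts
open GeneratingFunctions

proposition6 : (k : ℕ) → k ≥ 1 →
    (k ≥ 3 → E3-21 (decreasing k) ≋ 𝟘) ×
    (k ≡ 2 → E3-21 (decreasing k) ≋ exp (exp X) ⊗ ∫ (exp (⊖ exp X) ⊗ (exp X ⊖ 𝟙))) ×
    (k ≡ 1 → E3-21 (decreasing k) ≋ exp (exp X ⊖ 𝟙))
proposition6 k _ =
  (λ { (s≤s (s≤s (s≤s {n = k} _))) → E≋𝟘 (decreasing (3 ℕ.+ k)) (N-321…≡0 k) }) ,
  (λ { refl → descent-egf (decreasing 2) (N-21 0) N-21-suc }) ,
  (λ { refl → bell-egf (decreasing 1) (N-1 0) N-1-suc })
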